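{- Let $\mathsf{TA}=(\mathcal L,\mathcal I,\Gamma,\Pi,\mathcal R,RC)$ be a threshold automaton that has a (finite) multiplier $\mu>1$, and let $\sigma$ be a configuration. For $n\in\mathbb N$, fix sets of local states $\mathit{Locs}_m\subseteq\mathcal L$ for $1\le m\le n$, and let $$\psi=\bigwedge_{1\le m\le n}\ \bigvee_{\ell\in\mathit{Locs}_m}\boldsymbol\kappa[\ell]\neq 0 .$$ Then for every steady conventional schedule $\tau$ applicable to $\sigma$ with $\mathsf{Cfgs}(\sigma,\tau)\models\psi$, there exists a schedule $\rho=\mathsf{repr}_{\wedge\vee}[\psi,\mu\sigma,\mu\tau]$ with the following properties: (a) $\rho$ is a steady schedule applicable to $\mu\sigma$, and $\rho(\mu\sigma)=(\mu\tau)(\mu\sigma)$; (b) $|\rho|\le 4\cdot|\mathcal R|$; (c) $\mathsf{Cfgs}(\mu\sigma,\rho)\models\psi$; (d) $\rho=\mathsf{srep}[\mu\sigma,\tau]\cdot\mathsf{srep}[\tau(\mu\sigma),(\mu-1)\tau]$.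
   Context: **Threshold automata.** A threshold automaton is a tuple $\mathsf{TA}=(\mathcal L,\mathcal I,\Gamma,\Pi,\mathcal R,RC)$: $\mathcal L=\{1,\dots,|\mathcal L|\}$ is a finite set of local states, $\mathcal I\subseteq\mathcal L$ the initial local states; $\Gamma$ and $\Pi$ are finite sets of shared variables and parameters, ranging over $\mathbb N_0$; $RC$ is a linear integer arithmetic formula over $\Pi$, and $\mathbf P_{RC}=\{\mathbf p\in\mathbb N_0^{|\Pi|}:\mathbf p\models RC\}$ is the set of admissible parameter values; $\mathcal R$ is a finite set of rules. A rule is $r=(\mathit{from},\mathit{to},\varphi^{\le},\varphi^{>},\mathbf u)$ with $\mathit{from},\mathit{to}\in\mathcal L$, $\mathbf u\in\mathbb N_0^{|\Gamma|}$, $\varphi^{\le}$ a conjunction of lower guards $x\ge a_0+\sum_{i=1}^{|\Pi|}a_ip_i$, and $\varphi^{>}$ a conjunction of upper guards $x<a_0+\sum_{i=1}^{|\Pi|}a_ip_i$ ($x\in\Gamma$, $a_i\in\mathbb Z$, $p_i\in\Pi$). $\Phi^{\mathrm{rise}}$, $\Phi^{\mathrm{fall}}$ are the sets of lower and upper guards. Standing assumptions: a rule lying on a cycle (of the directed graph on $\mathcal L$ with edges $\mathit{from}\to\mathit{to}$) has $\mathbf u=\mathbf 0$; all cycles are simple, i.e. between any two locations in a cycle there is exactly one node-disjoint directed path (nodes in cycles may have self-loops). **Counter systems.** A configuration is $\sigma=(\boldsymbol\kappa,\mathbf g,\mathbf p)$ with counters $\sigma.\boldsymbol\kappa\in\mathbb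 N_0^{|\mathcal L|}$, shared variable values $\sigma.\mathbf g\in\mathbb N_0^{|\Gamma|}$ and parameter values $\sigma.\mathbf p=\mathbf p\in\mathbf P_{RC}$. A transition is $t=(\mathit{rule},\mathit{factor})$ with $\mathit{rule}\in\mathcal R$, $\mathit{factor}\in\mathbb N_0$; write $t.\mathit{from}=t.\mathit{rule}.\mathit{from}$, etc. $t$ is unlocked in $\sigma$ if for all $k\in\{0,\dots,t.\mathit{factor}-1\}$, $(\sigma.\boldsymbol\kappa,\sigma.\mathbf g+k\cdot t.\mathbf u,\sigma.\mathbf p)\models t.\varphi^{\le}\wedge t.\varphi^{>}$; it is applicable (enabled) in $\sigma$ if it is unlocked and $\sigma.\boldsymbol\kappa[t.\mathit{from}]\ge t.\mathit{factor}$, or $t.\mathit{factor}=0$. Then $\sigma'=t(\sigma)$ is given by $\sigma'.\mathbf g=\sigma.\mathbf g+t.\mathit{factor}\cdot t.\mathbf u$, $\sigma'.\mathbf p=\sigma.\mathbf p$, and $\sigma'.\boldsymbol\kappa$ is obtained from $\sigma.\boldsymbol\kappa$ by subtracting $t.\mathit{factor}$ at $t.\mathit{from}$ and adding it at $t.\mathit{to}$ (no change if $t.\mathit{from}=t.\mathit{to}$). A schedule is a sequence of transitions; $\tau=t_1,\dots,t_m$ is applicable to $\sigma_0$ if there are $\sigma_i=t_i(\sigma_{i-1})$ with $t_i$ applicable in $\sigma_{i-1}$; then $\tau(\sigma_0)=\sigma_m$. $|\tau|$ is the length, $\tau\cdot\tau'$ concatenation. A schedule is conventional if all factors are $1$.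 The context of $\sigma$ is $\omega(\sigma)=\{g\in\Phi^{\mathrm{rise}}:\sigma\models g\}\cup\{g\in\Phi^{\mathrm{fall}}:\sigma\not\models g\}$; $\tau$ is steady for $\sigma$ if all configurations visited when applying $\tau$ to $\sigma$ have the same context. $\mathsf{Cfgs}(\sigma,\tau)\models\psi$ means $\tau'(\sigma)\models\psi$ for every prefix $\tau'$ of $\tau$ (including the empty prefix and $\tau$). **Multipliers.** A multiplier of a threshold automaton is a number $\mu\in\mathbb N$ such that for every guard $\varphi$, if $(\sigma.\boldsymbol\kappa,\sigma.\mathbf g,\sigma.\mathbf p)\models\varphi$, then also $(\mu\cdot\sigma.\boldsymbol\kappa,\mu\cdot\sigma.\mathbf g,\mu\cdot\sigma.\mathbf p)\models\varphi$, and $\mu\cdot\sigma.\mathbf p\in\mathbf P_{RC}$. The configuration $\mu\sigma$ is $(\mu\cdot\sigma.\boldsymbol\kappa,\mu\cdot\sigma.\mathbf g,\mu\cdot\sigma.\mathbf p)$. For a conventional schedule $\tau$ and a positive integer $k$, $k\tau=\tau\cdot\ldots\cdot\tau$ ($k$ times). **Simple representatives $\mathsf{srep}$.** For rules, $r_1\prec_P r_2$ iff $r_1.\mathit{to}=r_2.\mathit{from}$; $\prec_P^+$ is the transitive closure; $r_1\sim_P r_2$ iff ($r_1\prec_P^+r_2$ and $r_2\prec_P^+r_1$) or $r_1=r_2$; $[r]$ is the $\sim_P$-class of $r$. For classes, $c_1\prec_C c_2$ iff there are $r_1,r_2$ with $[r_1]=c_1$, $[r_2]=c_2$, $r_1\prec_P^+r_2$,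 $r_1\not\sim_P r_2$. Fix a linear extension $\prec^{lin}_C$ of $\prec_C$. For a steady schedule $\tau$ applicable to $\sigma$, $\mathsf{srep}[\sigma,\tau]$ is constructed as follows. (i) Repeatedly swap neighboring transitions $t_1,t_2$ (in this order) whenever $[t_2]\prec^{lin}_C[t_1]$, until no such pair exists. (ii) Merge all neighboring transitions of the same rule into one (possibly accelerated) transition. (iii) For rules $r_1,\dots,r_j$ forming a loop, replace the subschedule $\tau_{\mathrm{loop}}$ of transitions belonging to the loop, starting in $\sigma_0$ and with $\sigma_{\mathrm{end}}=\tau_{\mathrm{loop}}(\sigma_0)$, by the schedule $(r_1,f_1),\dots,(r_j,f_j),(r_1,f_{j+1}),\dots,(r_j,f_{2j})$ from which transitions with zero factor are removed, where: if all of $r_1,\dots,r_j$ appear in $\tau_{\mathrm{loop}}$, then inductively $f_i=\sigma_{i-1}.\boldsymbol\kappa[r_i.\mathit{from}]-\min(\sigma_0.\boldsymbol\kappa[r_i.\mathit{from}],\sigma_{\mathrm{end}}.\boldsymbol\kappa[r_i.\mathit{from}])$ and $\sigma_i=(r_i,f_i)(\sigma_{i-1})$ for $1\le i\le j$, and $f_i=\sigma_{i-1}.\boldsymbol\kappa[r_{i-j}.\mathit{from}]-\sigma_{\mathrm{end}}.\boldsymbol\kappa[r_{i-j}.\mathit{from}]$ and $\sigma_i=(r_{i-j},f_i)(\sigma_{i-1})$ for $j+1\le i\le 2j$; otherwise, if $r_i$ is the first rule not appearing in $\tau_{\mathrm{loop}}$, then $f_\ell=0$ for $\ell\le i$ or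 $\ell\ge j+i$, $f_\ell$ is the sum of the factors of the transitions of $\tau_{\mathrm{loop}}$ with rule $r_\ell$ for $i<\ell\le j$, and with rule $r_{\ell-j}$ for $j<\ell<i+j$. Recalled fact (Konnov, Veith, Widder, CAV 2015): $\mathsf{srep}[\sigma,\tau]$ is steady, applicable to $\sigma$, $\mathsf{srep}[\sigma,\tau](\sigma)=\tau(\sigma)$, and $|\mathsf{srep}[\sigma,\tau]|\le 2|\mathcal R|$.
   Formalization: In (a), ρ is claimed steady only if μσ and μ·τ(σ) have the same context; without this, (a) fails, as multipliers need not reflect guards. "All cycles are simple" is read as excluding distinct cycles sharing a node and parallel rules on a cycle, where srep is ill-defined. -}

module Defs where

open import Data.Bool.Base using (if_then_else_)
open import Data.Fin.Base using (Fin)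
import Data.Fin.Properties as Fin
open import Data.Fin.Subset using (Subset)
import Data.Fin.Subset as Subset
open import Data.Integer.Base as ℤ using (ℤ; +_; 0ℤ)
open import Data.List.Base
  using (List; []; _∷_; _++_; [_]; map; concat; replicate; filter; foldr; span)
open import Data.List.Membership.Propositional using (_∈_)
import Data.List.Membership.DecPropositional as DecMembership
open import Data.List.Relation.Unary.All using (All)
open import Data.List.Relation.Unary.Unique.Propositional using (Unique)
open import Data.Nat.Base using (ℕ; zero; suc; _+_; _*_; _∸_; _<_; _≤_; _⊓_)
import Data.Nat.Properties as ℕ
open import Data.Nat.ListAction using (sum)
open import Data.Product.Base using (Σ; ∃; _×_; _,_; proj₁; proj₂)
open import Data.Sum.Base using (_⊎_)
open import Data.Unit.Base using (⊤)
open import Data.Vec.Base as Vec using (Vec; lookup; zipWith; updateAt)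
open import Function.Definitions using (Injective)
open import Level using (0ℓ)
open import Relation.Binary.Construct.Closure.ReflexiveTransitive using (Star; ε; _◅_; _◅◅_; gmap)
open import Relation.Binary.Construct.Closure.Transitive using (TransClosure)
open import Relation.Binary.Core using (Rel; _⇒_)
open import Relation.Binary.PropositionalEquality.Core using (_≡_; _≢_)
open import Relation.Binary.Structures using (IsStrictTotalOrder)
open import Relation.Nullary.Decidable.Core using (does; yes; no; ¬?)
open import Relation.Nullary.Negation.Core using (¬_)
open import Relation.Unary using (Pred; Decidable; _≐_)

record Linear (n : ℕ) : Set where
  field
    constant : ℤ
    coeffs   : Vec ℤ n

  eval : Vec ℤ n → ℤ
  eval v = constant ℤ.+ Vec.foldr _ ℤ._+_ 0ℤ (zipWith ℤ._*_ coeffs v)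

-- First-order formulas of linear integer arithmetic with n free variables;
-- the quantifiers bind the variable at index 0.
data Formula (n : ℕ) : Set where
  nonneg   : Linear n → Formula n
  neg      : Formula n → Formula n
  _and_    : Formula n → Formula n → Formula n
  _or_     : Formula n → Formula n → Formula n
  existsℤ  : Formula (suc n) → Formula n
  forallℤ  : Formula (suc n) → Formula n

Models : ∀ {n} → Vec ℤ n → Formula n → Set
Models v (nonneg a)  = 0ℤ ℤ.≤ Linear.eval a v
Models v (neg φ)     = ¬ Models v φ
Models v (φ and χ)   = Models v φ × Models v χ
Models v (φ or χ)    = Models v φ ⊎ Models v χ
Models v (existsℤ φ) = Σ ℤ λ z → Models (z Vec.∷ v) φ
Models v (forallℤ φ) = (z : ℤ) → Models (z Vec.∷ v) φ

-- Lower guards  x ≥ a₀ + Σ aᵢ pᵢ  are of kind rise,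
-- upper guards  x < a₀ + Σ aᵢ pᵢ  of kind fall.
data Kind : Set where
  rise fall : Kind

record Guard (nΓ nΠ : ℕ) (k : Kind) : Set where
  field
    var   : Fin nΓ
    bound : Linear nΠ

record Rule (nL nΓ nΠ : ℕ) : Set where
  field
    from   : Fin nL
    to     : Fin nL
    guards : (k : Kind) → List (Guard nΓ nΠ k)
    update : Vec ℕ nΓ

record ThresholdAutomaton : Set where
  field
    nL nΓ nΠ nR   : ℕ
    initial       : Subset nL
    rule          : Fin nR → Rule nL nΓ nΠ
    rule-distinct : Injective _≡_ _≡_ rule
    RC            : Formula nΠ

module CounterSystem (TA : ThresholdAutomaton) where
  open ThresholdAutomaton TA public

  Loc    = Fin nL
  RuleId = Fin nR

  module _ (r : RuleId) where
    open Rule (rule r) public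

  ------------------------------------------------------------------------
  -- Cycles

  Walk : Loc → List RuleId → Loc → Set
  Walk ℓ []       ℓ′ = ℓ ≡ ℓ′
  Walk ℓ (r ∷ rs) ℓ′ = from r ≡ ℓ × Walk (to r) rs ℓ′

  Cycle : List RuleId → Set
  Cycle rs = rs ≢ [] × ∃ λ ℓ → Walk ℓ rs ℓ

  OnCycle : RuleId → Set
  OnCycle r = ∃ λ rs → Cycle rs × r ∈ rs

  -- A directed path without self-loops that repeats no node, except that it may
  -- return to its first node at the end, in which case it is a simple cycle.
  Path : Loc → List RuleId → Loc → Set
  Path ℓ rs ℓ′ = rs ≢ [] × Walk ℓ rs ℓ′ × All (λ r → from r ≢ to r) rs
               × Unique (map from rs) × Unique (map to rs)

  -- For ℓ ≢ ℓ′ this says that the path from ℓ to ℓ′ (which exists along the cycle) is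
  -- the only one.  The case ℓ ≡ ℓ′ says that ℓ lies on at most one simple cycle, which
  -- excludes closed walks composed of different simple cycles sharing a node.
  SimpleCycles : Set
  SimpleCycles = ∀ {c} → Cycle c → ∀ {ℓ ℓ′} → ℓ ∈ map from c → ℓ′ ∈ map from c →
    ∀ {rs rs′} → Path ℓ rs ℓ′ → Path ℓ rs′ ℓ′ → rs ≡ rs′

  record StandingAssumptions : Set where
    field
      cycle-no-update : ∀ {r} → OnCycle r → update r ≡ Vec.replicate nΓ 0
      simple-cycles   : SimpleCycles

  ------------------------------------------------------------------------
  -- Configurations, transitions and schedules

  Admissible : Vec ℕ nΠ → Set
  Admissible p = Models (Vec.map +_ p) RC

  record Config : Set where
    constructor config
    field
      κ           : Vec ℕ nL
      g           : Vec ℕ nΓ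
      p           : Vec ℕ nΠ
      .admissible : Admissible p
  open Config public

  -- Guards do not refer to the counters, so satisfaction is defined on (g , p).
  Sat : ∀ {k} → Vec ℕ nΓ → Vec ℕ nΠ → Guard nΓ nΠ k → Set
  Sat {rise} g p φ = Linear.eval (Guard.bound φ) (Vec.map +_ p) ℤ.≤ + lookup g (Guard.var φ)
  Sat {fall} g p φ = + lookup g (Guard.var φ) ℤ.< Linear.eval (Guard.bound φ) (Vec.map +_ p)

  -- Φ rise and Φ fall are the sets of lower and upper guards of the automaton.
  Φ : (k : Kind) → Pred (Guard nΓ nΠ k) 0ℓ
  Φ k φ = ∃ λ r → φ ∈ guards r k

  Context : Config → Pred (∃ (Guard nΓ nΠ)) 0ℓ
  Context σ (rise , φ) = Φ rise φ × Sat (g σ) (p σ) φ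
  Context σ (fall , φ) = Φ fall φ × ¬ Sat (g σ) (p σ) φ

  SameContext : Rel Config 0ℓ
  SameContext σ σ′ = Context σ ≐ Context σ′

  record Transition : Set where
    constructor ⟨_,_⟩
    field
      ruleOf : RuleId
      factor : ℕ
  open Transition public

  Schedule : Set
  Schedule = List Transition

  infixl 6 _+ᵛ_
  infixl 7 _*ᵛ_

  _+ᵛ_ : ∀ {n} → Vec ℕ n → Vec ℕ n → Vec ℕ n
  _+ᵛ_ = zipWith _+_

  _*ᵛ_ : ∀ {n} → ℕ → Vec ℕ n → Vec ℕ n
  k *ᵛ v = Vec.map (k *_) v

  Unlocked : Config → Transition → Set
  Unlocked σ ⟨ r , f ⟩ = ∀ k → k < f → ∀ kind →
    All (Sat (g σ +ᵛ k *ᵛ update r) (p σ)) (guards r kind)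

  Enabled : Config → Transition → Set
  Enabled σ t = (Unlocked σ t × factor t ≤ lookup (κ σ) (from (ruleOf t))) ⊎ factor t ≡ 0

  move : Loc → Loc → ℕ → Vec ℕ nL → Vec ℕ nL
  move ℓ ℓ′ f κ with ℓ Fin.≟ ℓ′
  ... | yes _ = κ
  ... | no  _ = updateAt (updateAt κ ℓ (_∸ f)) ℓ′ (_+ f)

  fire : Transition → Config → Config
  fire ⟨ r , f ⟩ (config κ g p adm) = config (move (from r) (to r) f κ) (g +ᵛ f *ᵛ update r) p adm

  run : Schedule → Config → Config
  run []      σ = σ
  run (t ∷ τ) σ = run τ (fire t σ)

  Applicable : Config → Schedule → Set
  Applicable σ []      = ⊤
  Applicable σ (t ∷ τ) = Enabled σ t × Applicable (fire t σ) τ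

  Conventional : Schedule → Set
  Conventional = All (λ t → factor t ≡ 1)

  -- The configurations τ′(σ) for the prefixes τ′ of τ.
  Cfgs : Config → Schedule → List Config
  Cfgs σ []      = [ σ ]
  Cfgs σ (t ∷ τ) = σ ∷ Cfgs (fire t σ) τ

  Steady : Config → Schedule → Set
  Steady σ τ = ∀ {σ₁ σ₂} → σ₁ ∈ Cfgs σ τ → σ₂ ∈ Cfgs σ τ → SameContext σ₁ σ₂

  infixl 7 _·ˢ_

  _·ˢ_ : ℕ → Schedule → Schedule
  k ·ˢ τ = concat (replicate k τ)

  -- ⋀ₘ ⋁_{ℓ ∈ Locs m} κ[ℓ] ≠ 0
  ψ : ∀ {n} → (Fin n → Subset nL) → Pred Config 0ℓ
  ψ Locs σ = ∀ m → ∃ λ ℓ → ℓ Subset.∈ Locs m × lookup (κ σ) ℓ ≢ 0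

  ------------------------------------------------------------------------
  -- Multipliers

  record IsMultiplier (μ : ℕ) : Set where
    field
      preserves-guards : (σ : Config) → ∀ k φ → Φ k φ →
                         Sat (g σ) (p σ) φ → Sat (μ *ᵛ g σ) (μ *ᵛ p σ) φ
      preserves-RC     : (σ : Config) → Admissible (μ *ᵛ p σ)

  scale : ∀ {μ} → IsMultiplier μ → Config → Config
  scale {μ} mult σ =
    config (μ *ᵛ κ σ) (μ *ᵛ g σ) (μ *ᵛ p σ) (IsMultiplier.preserves-RC mult σ)

  ------------------------------------------------------------------------
  -- Rule classes and loops

  _≺P_ _≺P⁺_ _∼P_ _≺C_ : Rel RuleId 0ℓ
  r₁ ≺P r₂  = to r₁ ≡ from r₂
  _≺P⁺_     = TransClosure _≺P_
  r₁ ∼P r₂  = (r₁ ≺P⁺ r₂ × r₂ ≺P⁺ r₁) ⊎ r₁ ≡ r₂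
  -- Classes are represented by their members.
  c₁ ≺C c₂  = ∃ λ r₁ → ∃ λ r₂ → r₁ ∼P c₁ × r₂ ∼P c₂ × r₁ ≺P⁺ r₂ × ¬ r₁ ∼P r₂

  -- A strict total order on the setoid (RuleId , _∼P_), i.e. on the classes.
  record LinearExtension : Set₁ where
    field
      _≺lin_             : Rel RuleId 0ℓ
      isStrictTotalOrder : IsStrictTotalOrder _∼P_ _≺lin_
      extends            : _≺C_ ⇒ _≺lin_
    open IsStrictTotalOrder isStrictTotalOrder using (_<?_; asym) public

  IsLoop : List RuleId → Set
  IsLoop rs = Cycle rs × Unique (map from rs)

  -- When all cycles are simple, a rule on a cycle belongs to exactly one loop up to
  -- rotation.  An enumeration lists each loop once; the choice of the first rule r₁ of
  -- each loop, and the order of the loops, are arbitrary.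
  record LoopEnumeration : Set where
    field
      loops    : List (List RuleId)
      sound    : All IsLoop loops
      complete : ∀ {r} → OnCycle r → r ∈ concat loops
      distinct : Unique (concat loops)

  ------------------------------------------------------------------------
  -- Simple representatives

  module Swapping (lin : LinearExtension) where
    open LinearExtension lin

    infix 4 _⟶_

    data _⟶_ : Rel Schedule 0ℓ where
      here  : ∀ {t₁ t₂ τ} → ruleOf t₂ ≺lin ruleOf t₁ → t₁ ∷ t₂ ∷ τ ⟶ t₂ ∷ t₁ ∷ τ
      there : ∀ {t τ τ′} → τ ⟶ τ′ → t ∷ τ ⟶ t ∷ τ′

    sink : Transition → Schedule → Schedule
    sink t₁ []       = [ t₁ ]
    sink t₁ (t₂ ∷ τ) = if does (ruleOf t₂ <? ruleOf t₁) then t₂ ∷ sink t₁ τ else t₁ ∷ t₂ ∷ τ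

    -- Swapping neighbours exhaustively; swapAll-reached and swapAll-final show that
    -- this is what the function does.
    swapAll : Schedule → Schedule
    swapAll = foldr sink []

    sink-reached : ∀ t τ → Star _⟶_ (t ∷ τ) (sink t τ)
    sink-reached t₁ []       = ε
    sink-reached t₁ (t₂ ∷ τ) with ruleOf t₂ <? ruleOf t₁
    ... | yes lt = here lt ◅ gmap (t₂ ∷_) there (sink-reached t₁ τ)
    ... | no  _  = ε

    swapAll-reached : ∀ τ → Star _⟶_ τ (swapAll τ)
    swapAll-reached []      = ε
    swapAll-reached (t ∷ τ) =
      gmap (t ∷_) there (swapAll-reached τ) ◅◅ sink-reached t (swapAll τ)

    ∷-sink-final : ∀ t₁ t₂ τ → ruleOf t₂ ≺lin ruleOf t₁ →
      (∀ {τ′} → ¬ t₂ ∷ τ ⟶ τ′) → (∀ {τ′} → ¬ sink t₁ τ ⟶ τ′) →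
      ∀ {τ′} → ¬ t₂ ∷ sink t₁ τ ⟶ τ′
    ∷-sink-final t₁ t₂ []       lt fin fin′ (here lt′) = asym lt lt′
    ∷-sink-final t₁ t₂ []       lt fin fin′ (there s)  = fin′ s
    ∷-sink-final t₁ t₂ (t₃ ∷ τ) lt fin fin′ s with ruleOf t₃ <? ruleOf t₁
    ∷-sink-final t₁ t₂ (t₃ ∷ τ) lt fin fin′ (here lt′) | yes _ = fin (here lt′)
    ∷-sink-final t₁ t₂ (t₃ ∷ τ) lt fin fin′ (there s)  | yes _ = fin′ s
    ∷-sink-final t₁ t₂ (t₃ ∷ τ) lt fin fin′ (here lt′) | no _  = asym lt lt′
    ∷-sink-final t₁ t₂ (t₃ ∷ τ) lt fin fin′ (there s)  | no _  = fin′ s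

    sink-final : ∀ t τ → (∀ {τ′} → ¬ τ ⟶ τ′) → ∀ {τ′} → ¬ sink t τ ⟶ τ′
    sink-final t₁ []       fin (there ())
    sink-final t₁ (t₂ ∷ τ) fin s with ruleOf t₂ <? ruleOf t₁
    ... | yes lt = ∷-sink-final t₁ t₂ τ lt fin (sink-final t₁ τ (λ s′ → fin (there s′))) s
    sink-final t₁ (t₂ ∷ τ) fin (here lt) | no ≮ = ≮ lt
    sink-final t₁ (t₂ ∷ τ) fin (there s) | no _ = fin s

    swapAll-final : ∀ τ {τ′} → ¬ swapAll τ ⟶ τ′
    swapAll-final []      ()
    swapAll-final (t ∷ τ) = sink-final t (swapAll τ) (swapAll-final τ)

  pushMerge : Transition → Schedule → Schedule
  pushMerge t []      = [ t ]
  pushMerge t (u ∷ τ) = if does (ruleOf t Fin.≟ ruleOf u)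
    then ⟨ ruleOf t , factor t + factor u ⟩ ∷ τ
    else t ∷ u ∷ τ

  merge : Schedule → Schedule
  merge = foldr pushMerge []

  open DecMembership (Fin._≟_ {nR}) using (_∈?_)

  -- Fire the given rules one after the other from σ, each with the factor that leaves
  -- target ℓ processes in its source location ℓ.  In the uses below the subtraction
  -- is never truncated, since the counter is at least target ℓ.
  drain : (Loc → ℕ) → List RuleId → Config → Schedule
  drain target []       σ = []
  drain target (r ∷ rs) σ = t ∷ drain target rs (fire t σ)
    where t = ⟨ r , lookup (κ σ) (from r) ∸ target (from r) ⟩

  totalFactor : RuleId → Schedule → ℕ
  totalFactor r τ = sum (map factor (filter (λ t → ruleOf t Fin.≟ r) τ))

  twoRounds : List RuleId → Config → Config → Schedule
  twoRounds loop σ₀ σend = round₁ ++ drain end loop (run round₁ σ₀)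
    where
    start end : Loc → ℕ
    start  = lookup (κ σ₀)
    end    = lookup (κ σend)
    round₁ = drain (λ ℓ → start ℓ ⊓ end ℓ) loop σ₀

  -- τ is the subschedule of the transitions belonging to the loop r₁ … rⱼ; span splits
  -- the loop into r₁ … rᵢ₋₁ and rᵢ … rⱼ, where rᵢ is the first rule not appearing in τ.
  loopFactors : List RuleId → Config → Schedule → Schedule
  loopFactors loop σ₀ τ with span (_∈? map ruleOf τ) loop
  ... | _      , []        = twoRounds loop σ₀ (run τ σ₀)
  ... | before , _ ∷ after = map (λ r → ⟨ r , totalFactor r τ ⟩) (after ++ before)

  loopSchedule : List RuleId → Config → Schedule → Schedule
  loopSchedule loop σ₀ τ = filter (λ t → ¬? (factor t ℕ.≟ 0)) (loopFactors loop σ₀ τ)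

  InLoop? : (loop : List RuleId) → Decidable (λ t → ruleOf t ∈ loop)
  InLoop? loop t = ruleOf t ∈? loop

  -- The transitions of the loop need not be contiguous: transitions of self-loops at
  -- its locations, which are in the same rule class, may occur between them.  As a
  -- self-loop is a loop with j = 1, whose schedule is empty, those get removed as well.
  replaceLoop : Config → List RuleId → Schedule → Schedule
  replaceLoop σ loop τ with span (λ t → ¬? (InLoop? loop t)) τ
  ... | before , rest =
    before ++ loopSchedule loop (run before σ) (filter (InLoop? loop) rest)
           ++ filter (λ t → ¬? (InLoop? loop t)) rest

  srep : LinearExtension → LoopEnumeration → Config → Schedule → Schedule
  srep lin enum σ τ =
    foldr (replaceLoop σ) (merge (Swapping.swapAll lin τ)) (LoopEnumeration.loops enum)

-- Guards.  Along the steady schedule τ the truth values of its guards are constant, so its lower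
-- guards hold at σ and its upper guards at τ(σ).  The multiplier transfers them to μσ and μτ(σ),
-- and by monotonicity they hold for all values of the shared variables in between, which covers
-- every configuration visited by ρ.
--
-- Counters.  μσ = σ + (μ − 1)σ and τ(μσ) = (μ − 1)σ + τ(σ), where τ is applicable to σ and (μ − 1)τ
-- to (μ − 1)σ.  Hence τ and (μ − 1)τ can be applied without touching (μ − 1)σ and τ(σ), respectively,
-- and each step of the construction of srep preserves this: a class of rules consists of one loop
-- and self-loops, which can be moved and removed freely, and on a loop draining the excess of each
-- location twice around moves the counters from their start values to their end values.  So ψ is
-- inherited from σ in the first part of ρ and from τ(σ) in the second.
module Submission where

open import Defs
open import Data.Fin.Base using (Fin; zero; suc)
import Data.Fin.Properties as Fin
open import Data.Fin.Subset using (Subset)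
open import Data.Bool.Base using (if_then_else_; true; false)
import Data.Integer.Base as ℤ
import Data.Integer.Properties as ℤ
open import Data.List.Base
  using (List; []; _∷_; _++_; [_]; map; length; filter; concat; span; foldr; allFin)
open import Data.List.Membership.Propositional using (_∈_; _∉_)
open import Data.List.Membership.Propositional.Properties
  using (∈-++⁺ˡ; ∈-++⁺ʳ; ∈-++⁻; ∈-∃++; ∈-map⁺; ∈-map⁻; ∈-filter⁻; ∈-allFin)
import Data.List.Membership.DecPropositional as DecMembership
open import Data.List.Properties
  using (length-tabulate; length-++; map-++; ++-identityʳ; filter-none; map-cong-local; map-∘)
open import Data.List.Relation.Binary.Permutation.Propositional using (_↭_; ↭-sym; ↭-trans; ↭-reflexive; ↭⇒↭ₛ)
import Data.List.Relation.Binary.Permutation.Propositional.Properties as Perm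
import Data.List.Relation.Binary.Permutation.Setoid.Properties as SetoidPerm
open import Data.List.Relation.Unary.All as All using (All; []; _∷_)
import Data.List.Relation.Unary.All.Properties as All
open import Data.List.Relation.Unary.AllPairs as AllPairs using (AllPairs; []; _∷_)
import Data.List.Relation.Unary.AllPairs.Properties as AllPairs
open import Data.List.Relation.Unary.Any using (here; there)
open import Data.List.Relation.Binary.Subset.Propositional using (_⊆_)
import Data.List.Relation.Binary.Subset.Propositional.Properties as Subset
open import Data.List.Relation.Unary.Unique.Propositional using (Unique)
open import Data.Nat.Base
  using (ℕ; zero; suc; _+_; _*_; _∸_; _⊓_; _<_; _≤_; z≤n; s≤s)
open import Data.Nat.ListAction using (sum)
open import Data.Nat.ListAction.Properties using (sum-++)
open import Data.Nat.Properties as ℕ using ()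
open import Data.Nat.Tactic.RingSolver using (solve-∀)
open import Data.Product.Base using (∃; _×_; _,_; proj₁; proj₂)
open import Data.Sum.Base using (_⊎_; inj₁; inj₂)
open import Data.Unit.Base using (⊤; tt)
open import Data.Vec.Base as Vec using (Vec; lookup)
import Data.Vec.Properties as Vec
open import Function.Base using (_∘_; id; case_of_)
open import Relation.Binary.Definitions using (tri<; tri≈; tri>)
open import Relation.Binary.Construct.Closure.ReflexiveTransitive using (Star; ε; _◅_)
open import Relation.Binary.Construct.Closure.Transitive as Trans using (TransClosure; _∷_)
open import Relation.Binary.PropositionalEquality
  using (_≡_; _≢_; refl; sym; trans; cong; cong₂; subst; subst₂; setoid; ≢-sym; module ≡-Reasoning)
open import Relation.Binary.Structures using (IsStrictTotalOrder)
open import Relation.Nullary.Decidable.Core using (Dec; yes; no; does; ¬?; decidable-stable)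
open import Relation.Nullary.Negation.Core using (¬_; contradiction)
open import Relation.Unary using (Decidable)

-- The steps of `srep` share no obvious invariant. Swapping and merging keep the total factor of
-- every rule; the schedule of a loop may change these totals and keeps only where the processes end
-- up. Moreover, the schedules in between need not be applicable, because a merged self-loop may
-- carry a factor above its counter. Schedules are therefore compared through a relation that fixes
-- the final counters, the increase of the shared variables and the rules that may occur, and
-- feasibility disregards guards and self-loops. True applicability is recovered once, after the
-- self-loops are gone.
--
-- A multiplier preserves the truth of guards but not their falsity: with μ = 3, the guard x ≥ 5
-- fails at x = 1 and x = 2, yet it fails at 3 and holds at 6. Applicability of ρ is unaffected, as
-- the guards of the rules of τ all hold; that the visited contexts agree is drawn from the
-- agreement of the contexts of μσ and μτ(σ).
--
-- The 4 in the length bound is twice 2: each half of ρ contains every rule at most twice.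

-- Sums over lists, the Kronecker delta, and facts about lists

∑ : ∀ {A : Set} → (A → ℕ) → List A → ℕ
∑ h xs = sum (map h xs)

∑-cong : ∀ {A : Set} {h k : A → ℕ} {xs} → All (λ x → h x ≡ k x) xs → ∑ h xs ≡ ∑ k xs
∑-cong eqs = cong sum (map-cong-local eqs)

∑-++ : ∀ {A : Set} (h : A → ℕ) xs ys → ∑ h (xs ++ ys) ≡ ∑ h xs + ∑ h ys
∑-++ h xs ys = trans (cong sum (map-++ h xs ys)) (sum-++ (map h xs) (map h ys))

∑-+ : ∀ {A : Set} (h k : A → ℕ) xs → ∑ (λ x → h x + k x) xs ≡ ∑ h xs + ∑ k xs
∑-+ h k []       = refl
∑-+ h k (x ∷ xs) = trans (cong (h x + k x +_) (∑-+ h k xs)) (lemma (h x) (k x) (∑ h xs) (∑ k xs))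
  where
  lemma : ∀ a b c d → a + b + (c + d) ≡ a + c + (b + d)
  lemma = solve-∀

∑-* : ∀ {A : Set} m (h : A → ℕ) xs → ∑ (λ x → m * h x) xs ≡ m * ∑ h xs
∑-* m h []       = sym (ℕ.*-zeroʳ m)
∑-* m h (x ∷ xs) = trans (cong (m * h x +_) (∑-* m h xs)) (sym (ℕ.*-distribˡ-+ m (h x) (∑ h xs)))

∑-mono : ∀ {A : Set} {h k : A → ℕ} {xs} → All (λ x → h x ≤ k x) xs → ∑ h xs ≤ ∑ k xs
∑-mono []         = z≤n
∑-mono (le ∷ les) = ℕ.+-mono-≤ le (∑-mono les)

∑-zero : ∀ {A : Set} {h : A → ℕ} {xs} → All (λ x → h x ≡ 0) xs → ∑ h xs ≡ 0
∑-zero []         = refl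
∑-zero (eq ∷ eqs) = cong₂ _+_ eq (∑-zero eqs)

term-≤-∑ : ∀ {A : Set} (h : A → ℕ) {x xs} → x ∈ xs → h x ≤ ∑ h xs
term-≤-∑ h (here refl) = ℕ.m≤m+n _ _
term-≤-∑ h (there x∈)  = ℕ.≤-trans (term-≤-∑ h x∈) (ℕ.m≤n+m _ _)

∑-filter : ∀ {A : Set} {P : A → Set} (P? : Decidable P) (h : A → ℕ) xs →
  ∑ h (filter P? xs ++ filter (λ x → ¬? (P? x)) xs) ≡ ∑ h xs
∑-filter P? h xs = trans (∑-++ h (filter P? xs) _) (lemma xs)
  where
  lemma : ∀ xs → ∑ h (filter P? xs) + ∑ h (filter (λ x → ¬? (P? x)) xs) ≡ ∑ h xs
  lemma []       = refl
  lemma (x ∷ xs) with P? x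
  ... | yes _ = trans (ℕ.+-assoc (h x) _ _) (cong (h x +_) (lemma xs))
  ... | no  _ = trans (swap (∑ h (filter P? xs)) (h x) _) (cong (h x +_) (lemma xs))
    where
    swap : ∀ a b c → a + (b + c) ≡ b + (a + c)
    swap = solve-∀

∑-filter-≤ : ∀ {A : Set} {P : A → Set} (P? : Decidable P) (h : A → ℕ) xs → ∑ h (filter P? xs) ≤ ∑ h xs
∑-filter-≤ P? h xs = subst (∑ h (filter P? xs) ≤_)
  (trans (sym (∑-++ h (filter P? xs) _)) (∑-filter P? h xs)) (ℕ.m≤m+n _ _)

δ : ∀ {n} → Fin n → Fin n → ℕ
δ x y = if does (x Fin.≟ y) then 1 else 0

δ-≡ : ∀ {n} {x y : Fin n} → x ≡ y → δ x y ≡ 1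
δ-≡ {x = x} {y} eq with x Fin.≟ y
... | yes _ = refl
... | no  ne = contradiction eq ne

δ-≢ : ∀ {n} {x y : Fin n} → x ≢ y → δ x y ≡ 0
δ-≢ {x = x} {y} ne with x Fin.≟ y
... | yes eq = contradiction eq ne
... | no  _  = refl

*-δ-≡ : ∀ {n} m {x y : Fin n} → x ≡ y → m * δ x y ≡ m
*-δ-≡ m eq = trans (cong (m *_) (δ-≡ eq)) (ℕ.*-identityʳ m)

*-δ-≢ : ∀ {n} m {x y : Fin n} → x ≢ y → m * δ x y ≡ 0
*-δ-≢ m ne = trans (cong (m *_) (δ-≢ ne)) (ℕ.*-zeroʳ m)

∑-δ-∉ : ∀ {n} {y : Fin n} {xs} (h : Fin n → ℕ) → All (y ≢_) xs → ∑ (λ x → δ y x * h x) xs ≡ 0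
∑-δ-∉ {xs = xs} h y∉ = ∑-zero (All.map (λ {x} ne → cong (_* h x) (δ-≢ ne)) y∉)

∑-δ-∈ : ∀ {n} {y : Fin n} {xs} (h : Fin n → ℕ) → Unique xs → y ∈ xs →
  ∑ (λ x → δ y x * h x) xs ≡ h y
∑-δ-∈ {y = y} {x ∷ xs} h (x∉ ∷ _) (here refl) = begin
  δ y y * h y + ∑ (λ x → δ y x * h x) xs ≡⟨ cong₂ _+_ (cong (_* h y) (δ-≡ {x = y} refl)) (∑-δ-∉ h x∉) ⟩
  1 * h y + 0                            ≡⟨ ℕ.+-identityʳ _ ⟩
  1 * h y                                ≡⟨ ℕ.*-identityˡ _ ⟩
  h y                                    ∎
  where open ≡-Reasoning
∑-δ-∈ {y = y} {x ∷ xs} h (x∉ ∷ uniq) (there y∈) =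
  trans (cong (λ d → d * h x + _) (δ-≢ (≢-sym (All.lookup x∉ y∈)))) (∑-δ-∈ h uniq y∈)

∑-δ : ∀ {n} {y : Fin n} {xs} → Unique xs → y ∈ xs → ∑ (δ y) xs ≡ 1
∑-δ {y = y} {xs} uniq y∈ =
  trans (∑-cong (All.universal (λ x → sym (ℕ.*-identityʳ (δ y x))) xs)) (∑-δ-∈ (λ _ → 1) uniq y∈)

allPairs-map : ∀ {A : Set} {P : A → Set} {R S : A → A → Set} {xs} →
  (∀ {x y} → P x → P y → R x y → S x y) → All P xs → AllPairs R xs → AllPairs S xs
allPairs-map f []       []       = []
allPairs-map f (p ∷ ps) (r ∷ rs) = All.zipWith (λ (q , r) → f p q r) (ps , r) ∷ allPairs-map f ps rs

allPairs-all : ∀ {A : Set} {P : A → Set} {R : A → A → Set} {xs} →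
  (∀ {x y} → P x → P y → R x y) → All P xs → AllPairs R xs
allPairs-all f []       = []
allPairs-all f (p ∷ ps) = All.map (f p) ps ∷ allPairs-all f ps

allPairs-++⁻ : ∀ {A : Set} {R : A → A → Set} xs {ys} → AllPairs R (xs ++ ys) →
  AllPairs R xs × AllPairs R ys × All (λ x → All (R x) ys) xs
allPairs-++⁻ []       rs       = [] , rs , []
allPairs-++⁻ (x ∷ xs) (r ∷ rs) with All.++⁻ xs r | allPairs-++⁻ xs rs
... | r₁ , r₂ | rs₁ , rs₂ , rs₁₂ = r₁ ∷ rs₁ , rs₂ , r₂ ∷ rs₁₂

vec-ext : ∀ {A : Set} {n} {u v : Vec A n} → (∀ i → lookup u i ≡ lookup v i) → u ≡ v
vec-ext {u = u} {v} eq =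
  trans (sym (Vec.tabulate∘lookup u)) (trans (Vec.tabulate-cong eq) (Vec.tabulate∘lookup v))

Unique-resp-↭ : ∀ {A : Set} {xs ys : List A} → xs ↭ ys → Unique xs → Unique ys
Unique-resp-↭ {A} p = SetoidPerm.Unique-resp-↭ (setoid A) (↭⇒↭ₛ p)

span-spec : ∀ {A : Set} {P : A → Set} (P? : Decidable P) xs →
  let (ys , zs) = span P? xs in
  xs ≡ ys ++ zs × All P ys × (∀ {z zs′} → zs ≡ z ∷ zs′ → ¬ P z)
span-spec P? []       = refl , [] , λ ()
span-spec P? (x ∷ xs) with P? x
... | no  ¬px = refl , [] , λ { refl → ¬px }
... | yes px  with span-spec P? xs
...   | eq , pys , ¬pz = cong (x ∷_) eq , px ∷ pys , ¬pz

module _ (TA : ThresholdAutomaton) where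
  open CounterSystem TA
  open DecMembership (Fin._≟_ {nR}) using (_∈?_)

  SelfLoop : RuleId → Set
  SelfLoop r = from r ≡ to r

  selfLoop? : Decidable SelfLoop
  selfLoop? r = from r Fin.≟ to r

  -- Walks and loops

  walk-++ : ∀ {ℓ ℓ′ ℓ″} rs {rs′} → Walk ℓ rs ℓ′ → Walk ℓ′ rs′ ℓ″ → Walk ℓ (rs ++ rs′) ℓ″
  walk-++ []       refl     w′ = w′
  walk-++ (r ∷ rs) (eq , w) w′ = eq , walk-++ rs w w′

  walk-++⁻ : ∀ {ℓ ℓ″} rs {rs′} → Walk ℓ (rs ++ rs′) ℓ″ → ∃ λ ℓ′ → Walk ℓ rs ℓ′ × Walk ℓ′ rs′ ℓ″
  walk-++⁻ []       w        = _ , refl , w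
  walk-++⁻ (r ∷ rs) (eq , w) with walk-++⁻ rs w
  ... | ℓ′ , w₁ , w₂ = ℓ′ , (eq , w₁) , w₂

  walk-to : ∀ {ℓ ℓ′} rs → Walk ℓ rs ℓ′ → ∀ {r} → r ∈ rs → to r ∈ map from rs ⊎ to r ≡ ℓ′
  walk-to (r ∷ [])      (_ , eq)     (here refl) = inj₂ eq
  walk-to (r ∷ r′ ∷ rs) (_ , eq , _) (here refl) = inj₁ (there (here (sym eq)))
  walk-to (r ∷ rs)      (_ , w)      (there r∈)  with walk-to rs w r∈
  ... | inj₁ ∈froms = inj₁ (there ∈froms)
  ... | inj₂ eq     = inj₂ eq

  closed-to : ∀ {ℓ} rs → Walk ℓ rs ℓ → ∀ {r} → r ∈ rs → to r ∈ map from rs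
  closed-to rs w r∈ with walk-to rs w r∈
  closed-to (r ∷ rs) (eq , w) _ | inj₂ eq′ = here (trans eq′ (sym eq))
  ... | inj₁ ∈froms = ∈froms

  -- Both sides list the visited nodes in order. For a closed walk this makes the targets a
  -- permutation of the sources, so distinct sources suffice for a `Path`.
  walk-nodes : ∀ {ℓ ℓ′} rs → Walk ℓ rs ℓ′ → ℓ ∷ map to rs ≡ map from rs ++ [ ℓ′ ]
  walk-nodes []       refl       = refl
  walk-nodes (r ∷ rs) (refl , w) = cong (from r ∷_) (walk-nodes rs w)

  -- Unlike `Path`, it forbids returning to the start: keeping the endpoint out of the sources makes
  -- all visited nodes distinct and excludes self-loops.
  SimpleWalk : Loc → List RuleId → Loc → Set
  SimpleWalk ℓ rs ℓ′ = Walk ℓ rs ℓ′ × Unique (map from rs) × ℓ′ ∉ map from rs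

  simple-nonself : ∀ {ℓ ℓ′} rs → SimpleWalk ℓ rs ℓ′ → All (¬_ ∘ SelfLoop) rs
  simple-nonself []            _                            = []
  simple-nonself (r ∷ [])      ((_ , eq) , _ , ∉froms)      = (λ self → ∉froms (here (trans (sym eq) (sym self)))) ∷ []
  simple-nonself (r ∷ r′ ∷ rs) ((_ , eq , w) , (r∉ ∷ uniq) , ∉froms) =
    (λ self → All.head r∉ (trans self (sym eq)))
    ∷ simple-nonself (r′ ∷ rs) ((eq , w) , uniq , ∉froms ∘ there)

  suffix-from : ∀ {ℓ ℓ′ ℓ″} rs → SimpleWalk ℓ rs ℓ′ → ℓ″ ∈ map from rs → ∃ λ rs′ → SimpleWalk ℓ″ rs′ ℓ′
  suffix-from (r ∷ rs) ((_ , w) , uniq , ∉froms)       (here refl) = r ∷ rs , (refl , w) , uniq , ∉froms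
  suffix-from (r ∷ rs) ((_ , w) , (_ ∷ uniq) , ∉froms) (there ∈rs) = suffix-from rs (w , uniq , ∉froms ∘ there) ∈rs

  open DecMembership (Fin._≟_ {nL}) using () renaming (_∈?_ to _∈ℓ?_)

  -- Erase the tail first; if the start still occurs on the erased tail, the part of the tail from
  -- there on already serves.
  loop-erase : ∀ {ℓ ℓ′} rs → Walk ℓ rs ℓ′ → ∃ λ rs′ → SimpleWalk ℓ rs′ ℓ′
  loop-erase []       w = [] , w , [] , λ ()
  loop-erase {ℓ} {ℓ′} (r ∷ rs) (eq , w) with ℓ Fin.≟ ℓ′
  ... | yes ℓ≡ℓ′ = [] , ℓ≡ℓ′ , [] , λ ()
  ... | no  ℓ≢ℓ′ with loop-erase rs w
  ...   | rs′ , w′ , uniq , ∉froms with ℓ ∈ℓ? map from rs′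
  ...     | yes ℓ∈ = suffix-from rs′ (w′ , uniq , ∉froms) ℓ∈
  ...     | no  ℓ∉ = r ∷ rs′ , (eq , w′)
    , All.tabulate (λ x∈ from≡x → ℓ∉ (subst (_∈ map from rs′) (trans (sym from≡x) eq) x∈)) ∷ uniq
    , λ { (here ℓ′≡) → ℓ≢ℓ′ (trans (sym eq) (sym ℓ′≡)) ; (there ℓ′∈) → ∉froms ℓ′∈ }

  closed-path : ∀ {ℓ} rs → rs ≢ [] → Walk ℓ rs ℓ → All (¬_ ∘ SelfLoop) rs → Unique (map from rs) →
    Path ℓ rs ℓ
  closed-path {ℓ} rs rs≢[] w nonself uniq = rs≢[] , w , nonself , uniq , Unique-resp-↭ froms↭tos uniq
    where
    froms↭tos : map from rs ↭ map to rs
    froms↭tos = Perm.drop-∷ {x = ℓ}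
      (↭-trans (Perm.++-comm [ ℓ ] (map from rs)) (↭-reflexive (sym (walk-nodes rs w))))

  rotate : ∀ {ℓ rs r} → Walk ℓ rs ℓ → r ∈ rs → ∃ λ rs′ → Walk (from r) (r ∷ rs′) (from r) × rs ↭ r ∷ rs′
  rotate w r∈ with ∈-∃++ r∈
  ... | xs , ys , refl with walk-++⁻ xs w
  ...   | _ , w₁ , (eq , w₂) rewrite sym eq =
    ys ++ xs , (refl , walk-++ ys w₂ w₁) , Perm.++-comm xs _

  -- After a self-loop the next rule has the same source, which distinct sources forbid; so a loop
  -- containing a self-loop consists of it alone.
  loop-selfLoop : ∀ {L} → IsLoop L → (∃ λ r → L ≡ [ r ] × SelfLoop r) ⊎ All (¬_ ∘ SelfLoop) L
  loop-selfLoop {[]} _ = inj₂ []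
  loop-selfLoop {r ∷ rs} ((_ , ℓ , eq , w) , r∉ ∷ uniq) with selfLoop? r
  loop-selfLoop {r ∷ []} _ | yes self = inj₁ (r , refl , self)
  loop-selfLoop {r ∷ r′ ∷ rs} ((_ , ℓ , eq , eq′ , w) , r∉ ∷ uniq) | yes self =
    contradiction (trans self (sym eq′)) (All.head r∉)
  ... | no nonself = inj₂ (nonself ∷ simple-nonself rs
    (w , uniq , λ ℓ∈ → All.lookup r∉ ℓ∈ eq))

  walk⁺ : ∀ {r₁ r₂} → r₁ ≺P⁺ r₂ → ∃ λ rs → Walk (to r₁) rs (from r₂)
  walk⁺ TransClosure.[ eq ] = [] , eq
  walk⁺ (eq ∷ r≺s) with walk⁺ r≺s
  ... | rs , w = _ ∷ rs , sym eq , w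

  self-onCycle : ∀ {r} → SelfLoop r → OnCycle r
  self-onCycle {r} self = [ r ] , ((λ ()) , from r , refl , sym self) , here refl

  loop-onCycle : ∀ {L r} → IsLoop L → r ∈ L → OnCycle r
  loop-onCycle (cyc , _) r∈ = _ , cyc , r∈

  ≺P⁺-onCycle : ∀ {r} → r ≺P⁺ r → OnCycle r
  ≺P⁺-onCycle {r} r≺r with walk⁺ r≺r
  ... | rs , w = r ∷ rs , ((λ ()) , from r , refl , w) , here refl

  -- Simple cycles and the rule class of a loop

  module _ (simple : SimpleCycles) {L} (loop : IsLoop L) (nonself : All (¬_ ∘ SelfLoop) L) where

    -- The loop-erased way back closes `s` to a simple cycle through its source, and rotating `L`
    -- gives another one through the same location. `SimpleCycles` with equal endpoints identifies
    -- the two, so `s` is the first rule of the rotated loop.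
    loop-absorbs : ∀ {s rs} → from s ∈ map from L → ¬ SelfLoop s → Walk (to s) rs (from s) → s ∈ L
    loop-absorbs {s} {rs} s∈froms s-nonself back
      with ∈-map⁻ from s∈froms | loop-erase rs back
    ... | r , r∈ , from-s≡from-r | rs′ , w′ , uniq′ , s∉ with rotate (proj₂ (proj₂ (proj₁ loop))) r∈
    ...   | L′ , wL , L↭ = Perm.∈-resp-↭ (↭-sym L↭) (subst (s ∈_) same (here refl))
      where
      path : Path (from s) (s ∷ rs′) (from s)
      path = closed-path _ (λ ()) (refl , w′)
        (s-nonself ∷ simple-nonself rs′ (w′ , uniq′ , s∉))
        (All.tabulate (λ { x∈ refl → s∉ x∈ }) ∷ uniq′)

      pathL : Path (from s) (r ∷ L′) (from s)
      pathL = closed-path _ (λ ()) (subst (λ ℓ → Walk ℓ (r ∷ L′) ℓ) (sym from-s≡from-r) wL)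
        (Perm.All-resp-↭ L↭ nonself) (Unique-resp-↭ (Perm.map⁺ from L↭) (proj₂ loop))

      same : s ∷ rs′ ≡ r ∷ L′
      same = simple (proj₁ loop) s∈froms s∈froms path pathL

    -- Every step can be returned from, by the remaining walk followed by `back`. So each step is
    -- either a self-loop or absorbed by the loop, whose targets are again its locations.
    walk-stays : ∀ {ℓ ℓ′ back} rs → ℓ ∈ map from L → Walk ℓ rs ℓ′ → Walk ℓ′ back ℓ → ℓ′ ∈ map from L
    walk-stays []       ℓ∈ refl       _  = ℓ∈
    walk-stays (s ∷ rs) ℓ∈ (refl , w) w′ = walk-stays rs to∈ w (walk-++ _ w′ (refl , refl))
      where
      to∈ : to s ∈ map from L
      to∈ with selfLoop? s
      ... | yes self = subst (_∈ map from L) self ℓ∈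
      ... | no  ¬self = closed-to L (proj₂ (proj₂ (proj₁ loop)))
        (loop-absorbs ℓ∈ ¬self (walk-++ rs w w′))

    -- The class of a loop consists of the loop and the self-loops at its locations.
    class-of-loop : ∀ {r u} → r ∈ L → r ∼P u → u ∉ L → SelfLoop u
    class-of-loop r∈ (inj₂ refl) u∉ = contradiction r∈ u∉
    class-of-loop {r} {u} r∈ (inj₁ (r≺u , u≺r)) u∉ with selfLoop? u | walk⁺ r≺u | walk⁺ u≺r
    ... | yes self | _ | _ = self
    ... | no ¬self | rs , w | rs′ , w′ = contradiction
      (loop-absorbs (walk-stays rs (closed-to L (proj₂ (proj₂ (proj₁ loop))) r∈) w (refl , u→r))
                    ¬self (walk-++ _ u→r w))
      u∉
      where
      u→r : Walk (to u) (rs′ ++ [ r ]) (to r)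
      u→r = walk-++ rs′ w′ (refl , refl)

  -- Counters

  Counters : Set
  Counters = Vec ℕ nL

  shift : Transition → Counters → Counters
  shift ⟨ r , f ⟩ = move (from r) (to r) f

  shifts : Schedule → Counters → Counters
  shifts []      k = k
  shifts (t ∷ τ) k = shifts τ (shift t k)

  shifts-++ : ∀ τ τ′ k → shifts (τ ++ τ′) k ≡ shifts τ′ (shifts τ k)
  shifts-++ []      τ′ k = refl
  shifts-++ (t ∷ τ) τ′ k = shifts-++ τ τ′ (shift t k)

  κ-run : ∀ τ σ → κ (run τ σ) ≡ shifts τ (κ σ)
  κ-run []      σ = refl
  κ-run (t ∷ τ) σ = κ-run τ (fire t σ)

  -- The quantities that matter are of this form: the weights `out x` and `into x` give the flow at
  -- a location, `gain i` the increase of a shared variable.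
  wsum : (RuleId → ℕ) → Schedule → ℕ
  wsum w = ∑ (λ t → factor t * w (ruleOf t))

  out into : Loc → RuleId → ℕ
  out  ℓ r = δ (from r) ℓ
  into ℓ r = δ (to r) ℓ

  -- Processes that a schedule has to leave in place. The reserve is a parameter of feasibility so
  -- that every rewriting step carries it along; the zero reserve gives back the ordinary counter
  -- condition.
  Reserve : Set
  Reserve = Loc → ℕ

  infix 4 _≤ᵏ_
  _≤ᵏ_ : Reserve → Counters → Set
  c ≤ᵏ k = ∀ ℓ → c ℓ ≤ lookup k ℓ

  -- Guards are ignored, and so is the counter condition for self-loops: merging transitions
  -- of a self-loop yields a factor that may exceed the counter until the self-loop is removed.
  data Safe (c : Reserve) (k : Counters) (t : Transition) : Set where
    idle : SelfLoop (ruleOf t) → Safe c k t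
    able : factor t + c (from (ruleOf t)) ≤ lookup k (from (ruleOf t)) → Safe c k t

  Feasible : Reserve → Counters → Schedule → Set
  Feasible c k []      = ⊤
  Feasible c k (t ∷ τ) = Safe c k t × Feasible c (shift t k) τ

  safe-weaken : ∀ {c d k} t → (∀ ℓ → d ℓ ≤ c ℓ) → Safe c k t → Safe d k t
  safe-weaken t d≤c (idle self) = idle self
  safe-weaken t d≤c (able le)   = able (ℕ.≤-trans (ℕ.+-monoʳ-≤ (factor t) (d≤c _)) le)

  feasible-weaken : ∀ {c d k} τ → (∀ ℓ → d ℓ ≤ c ℓ) → Feasible c k τ → Feasible d k τ
  feasible-weaken []      d≤c _         = tt
  feasible-weaken (t ∷ τ) d≤c (s , fea) = safe-weaken t d≤c s , feasible-weaken τ d≤c fea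

  shift-self : ∀ t k → SelfLoop (ruleOf t) → shift t k ≡ k
  shift-self ⟨ r , f ⟩ k self with from r Fin.≟ to r
  ... | yes _ = refl
  ... | no  ne = contradiction self ne

  -- Conservation of flow, with the outflow moved to the left so that no truncated subtraction
  -- appears. For a self-loop both flow terms coincide.
  shift-balance : ∀ {c k} t → Safe c k t → ∀ x →
    lookup (shift t k) x + factor t * out x (ruleOf t) ≡ lookup k x + factor t * into x (ruleOf t)
  shift-balance {k = k} ⟨ r , f ⟩ s x with from r Fin.≟ to r
  ... | yes self = cong (λ ℓ → lookup k x + f * δ ℓ x) self
  shift-balance ⟨ r , f ⟩ (idle self) x | no ne = contradiction self ne
  shift-balance {c} {k} ⟨ r , f ⟩ (able le) x | no ne with to r Fin.≟ x | from r Fin.≟ x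
  ... | yes refl | yes eq = contradiction eq ne
  ... | yes refl | no _   = begin
    lookup (Vec.updateAt k′ (to r) (_+ f)) (to r) + f * 0 ≡⟨ cong₂ _+_ (Vec.lookup∘updateAt (to r) k′) (ℕ.*-zeroʳ f) ⟩
    lookup k′ (to r) + f + 0                              ≡⟨ ℕ.+-identityʳ _ ⟩
    lookup k′ (to r) + f                                  ≡⟨ cong₂ _+_ (Vec.lookup∘updateAt′ (to r) (from r) (≢-sym ne) k) (sym (ℕ.*-identityʳ f)) ⟩
    lookup k (to r) + f * 1                               ∎
    where
    open ≡-Reasoning
    k′ = Vec.updateAt k (from r) (_∸ f)
  ... | no to≢x | yes refl = begin
    lookup (Vec.updateAt k′ (to r) (_+ f)) (from r) + f * 1 ≡⟨ cong₂ _+_ (Vec.lookup∘updateAt′ (from r) (to r) ne k′) (ℕ.*-identityʳ f) ⟩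
    lookup k′ (from r) + f                                  ≡⟨ cong (_+ f) (Vec.lookup∘updateAt (from r) k) ⟩
    lookup k (from r) ∸ f + f                               ≡⟨ ℕ.m∸n+n≡m (ℕ.≤-trans (ℕ.m≤m+n f _) le) ⟩
    lookup k (from r)                                       ≡⟨ sym (trans (cong (lookup k (from r) +_) (ℕ.*-zeroʳ f)) (ℕ.+-identityʳ _)) ⟩
    lookup k (from r) + f * 0                               ∎
    where
    open ≡-Reasoning
    k′ = Vec.updateAt k (from r) (_∸ f)
  ... | no to≢x | no from≢x = cong (_+ f * 0) (begin
    lookup (Vec.updateAt k′ (to r) (_+ f)) x ≡⟨ Vec.lookup∘updateAt′ x (to r) (≢-sym to≢x) k′ ⟩
    lookup k′ x                              ≡⟨ Vec.lookup∘updateAt′ x (from r) (≢-sym from≢x) k ⟩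
    lookup k x                               ∎)
    where
    open ≡-Reasoning
    k′ = Vec.updateAt k (from r) (_∸ f)

  shift-from : ∀ {c k} t → ¬ SelfLoop (ruleOf t) → Safe c k t →
    lookup (shift t k) (from (ruleOf t)) + factor t ≡ lookup k (from (ruleOf t))
  shift-from {k = k} t nonself s = begin
    lookup (shift t k) ℓ + factor t                       ≡⟨ cong (lookup (shift t k) ℓ +_) (sym (*-δ-≡ (factor t) {ℓ} refl)) ⟩
    lookup (shift t k) ℓ + factor t * out ℓ (ruleOf t)    ≡⟨ shift-balance t s ℓ ⟩
    lookup k ℓ + factor t * into ℓ (ruleOf t)             ≡⟨ cong (lookup k ℓ +_) (*-δ-≢ (factor t) (nonself ∘ sym)) ⟩
    lookup k ℓ + 0                                        ≡⟨ ℕ.+-identityʳ _ ⟩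
    lookup k ℓ                                            ∎
    where
    open ≡-Reasoning
    ℓ = from (ruleOf t)

  shift-other : ∀ {c k x} t → Safe c k t → from (ruleOf t) ≢ x →
    lookup (shift t k) x ≡ lookup k x + factor t * into x (ruleOf t)
  shift-other {k = k} {x} t s ne = begin
    lookup (shift t k) x                               ≡⟨ ℕ.+-identityʳ _ ⟨
    lookup (shift t k) x + 0                           ≡⟨ cong (lookup (shift t k) x +_) (sym (*-δ-≢ (factor t) ne)) ⟩
    lookup (shift t k) x + factor t * out x (ruleOf t) ≡⟨ shift-balance t s x ⟩
    lookup k x + factor t * into x (ruleOf t)          ∎
    where open ≡-Reasoning

  shift-other-≥ : ∀ {c k x} t → Safe c k t → from (ruleOf t) ≢ x → lookup k x ≤ lookup (shift t k) x
  shift-other-≥ t s ne = ℕ.≤-trans (ℕ.m≤m+n _ _) (ℕ.≤-reflexive (sym (shift-other t s ne)))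

  shift-untouched : ∀ {c k x} t → Safe c k t → from (ruleOf t) ≢ x → to (ruleOf t) ≢ x →
    lookup (shift t k) x ≡ lookup k x
  shift-untouched {k = k} {x} t s from≢ to≢ = trans (shift-other t s from≢)
    (trans (cong (lookup k x +_) (*-δ-≢ (factor t) to≢)) (ℕ.+-identityʳ _))

  -- Only the source of a transition loses processes, and there `able` demands the reserve on top of
  -- the factor.
  shift-≥ : ∀ {c k} t → Safe c k t → c ≤ᵏ k → c ≤ᵏ shift t k
  shift-≥ {c} {k} t s c≤k ℓ = go s (selfLoop? (ruleOf t)) (from (ruleOf t) Fin.≟ ℓ)
    where
    go : Safe c k t → Dec (SelfLoop (ruleOf t)) → Dec (from (ruleOf t) ≡ ℓ) → c ℓ ≤ lookup (shift t k) ℓ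
    go _           (yes self) _          rewrite shift-self t k self = c≤k ℓ
    go (idle self) (no ¬self) _          = contradiction self ¬self
    go (able le)   (no ¬self) (no ne)    = ℕ.≤-trans (c≤k ℓ) (shift-other-≥ t s ne)
    go (able le)   (no ¬self) (yes refl) = ℕ.+-cancelˡ-≤ (factor t) _ _
      (ℕ.≤-trans le (ℕ.≤-reflexive (trans (sym (shift-from t ¬self s)) (ℕ.+-comm _ (factor t)))))

  shifts-≥ : ∀ {c k} τ → Feasible c k τ → c ≤ᵏ k → c ≤ᵏ shifts τ k
  shifts-≥ []      _         c≤k = c≤k
  shifts-≥ (t ∷ τ) (s , fea) c≤k = shifts-≥ τ fea (shift-≥ t s c≤k)

  feasible-++⁺ : ∀ {c k} τ {τ′} → Feasible c k τ → Feasible c (shifts τ k) τ′ → Feasible c k (τ ++ τ′)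
  feasible-++⁺ []      _         fea′ = fea′
  feasible-++⁺ (t ∷ τ) (s , fea) fea′ = s , feasible-++⁺ τ fea fea′

  feasible-++⁻ : ∀ {c k} τ {τ′} → Feasible c k (τ ++ τ′) → Feasible c k τ × Feasible c (shifts τ k) τ′
  feasible-++⁻ []      fea       = tt , fea
  feasible-++⁻ (t ∷ τ) (s , fea) with feasible-++⁻ τ fea
  ... | fea₁ , fea₂ = (s , fea₁) , fea₂

  shifts-balance : ∀ {c k} τ → Feasible c k τ → ∀ x →
    lookup (shifts τ k) x + wsum (out x) τ ≡ lookup k x + wsum (into x) τ
  shifts-balance []      _         x = refl
  shifts-balance {k = k} (t ∷ τ) (s , fea) x = begin
    e + (o + O)  ≡⟨ rearrange e o O ⟩
    (e + O) + o  ≡⟨ cong (_+ o) (shifts-balance τ fea x) ⟩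
    k₁ + I + o   ≡⟨ swap k₁ I o ⟩
    k₁ + o + I   ≡⟨ cong (_+ I) (shift-balance t s x) ⟩
    k₀ + i + I   ≡⟨ ℕ.+-assoc k₀ i I ⟩
    k₀ + (i + I) ∎
    where
    open ≡-Reasoning
    e  = lookup (shifts τ (shift t k)) x
    k₁ = lookup (shift t k) x
    k₀ = lookup k x
    o  = factor t * out x (ruleOf t)
    i  = factor t * into x (ruleOf t)
    O  = wsum (out x) τ
    I  = wsum (into x) τ
    rearrange : ∀ a b c → a + (b + c) ≡ a + c + b
    rearrange = solve-∀
    swap : ∀ a b c → a + b + c ≡ a + c + b
    swap = solve-∀

  -- Equal total factor for every rule, phrased through all weights at once, so that neither the
  -- order nor the splitting into transitions is mentioned.
  SameSums : Schedule → Schedule → Set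
  SameSums τ τ′ = ∀ w → wsum w τ ≡ wsum w τ′

  -- By the balance equation the final counter of a location is its initial one plus inflow minus
  -- outflow, and both flows are weighted sums.
  shifts-determined : ∀ {c k} τ τ′ → Feasible c k τ → Feasible c k τ′ → SameSums τ τ′ →
    shifts τ k ≡ shifts τ′ k
  shifts-determined {k = k} τ τ′ fea fea′ sums = vec-ext λ x →
    ℕ.+-cancelʳ-≡ (wsum (out x) τ) _ _ (begin
      lookup (shifts τ k) x + wsum (out x) τ   ≡⟨ shifts-balance τ fea x ⟩
      lookup k x + wsum (into x) τ             ≡⟨ cong (lookup k x +_) (sums (into x)) ⟩
      lookup k x + wsum (into x) τ′            ≡⟨ shifts-balance τ′ fea′ x ⟨
      lookup (shifts τ′ k) x + wsum (out x) τ′ ≡⟨ cong (lookup (shifts τ′ k) x +_) (sums (out x)) ⟨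
      lookup (shifts τ′ k) x + wsum (out x) τ  ∎)
    where open ≡-Reasoning

  shifts-untouched : ∀ {c k x} τ → Feasible c k τ →
    All (λ t → from (ruleOf t) ≢ x × to (ruleOf t) ≢ x) τ → lookup (shifts τ k) x ≡ lookup k x
  shifts-untouched []      _         []                     = refl
  shifts-untouched (t ∷ τ) (s , fea) ((from≢ , to≢) ∷ rest) =
    trans (shifts-untouched τ fea rest) (shift-untouched t s from≢ to≢)

  infixl 6 _⊕_
  _⊕_ : Reserve → Counters → Reserve
  (c ⊕ d) ℓ = c ℓ + lookup d ℓ

  lookup-+ᵛ : ∀ (k d : Counters) ℓ → lookup (k +ᵛ d) ℓ ≡ lookup k ℓ + lookup d ℓ
  lookup-+ᵛ k d ℓ = Vec.lookup-zipWith _+_ ℓ k d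

  safe-offset : ∀ {c k} t d → Safe c k t → Safe (c ⊕ d) (k +ᵛ d) t
  safe-offset         t d (idle self) = idle self
  safe-offset {c} {k} t d (able le) = able (begin
    factor t + (c (from (ruleOf t)) + lookup d _) ≡⟨ ℕ.+-assoc (factor t) _ _ ⟨
    factor t + c (from (ruleOf t)) + lookup d _   ≤⟨ ℕ.+-monoˡ-≤ _ le ⟩
    lookup k _ + lookup d _                       ≡⟨ lookup-+ᵛ k d (from (ruleOf t)) ⟨
    lookup (k +ᵛ d) (from (ruleOf t))             ∎)
    where open ℕ.≤-Reasoning

  shift-offset : ∀ {c k} t d → Safe c k t → shift t (k +ᵛ d) ≡ shift t k +ᵛ d
  shift-offset {c} {k} t d s = vec-ext λ x → ℕ.+-cancelʳ-≡ (factor t * out x (ruleOf t)) _ _ (begin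
    lookup (shift t (k +ᵛ d)) x + o x        ≡⟨ shift-balance t (safe-offset t d s) x ⟩
    lookup (k +ᵛ d) x + i x                  ≡⟨ cong (_+ i x) (lookup-+ᵛ k d x) ⟩
    lookup k x + lookup d x + i x            ≡⟨ swap (lookup k x) (lookup d x) (i x) ⟩
    lookup k x + i x + lookup d x            ≡⟨ cong (_+ lookup d x) (shift-balance t s x) ⟨
    lookup (shift t k) x + o x + lookup d x  ≡⟨ swap (lookup (shift t k) x) (o x) (lookup d x) ⟩
    lookup (shift t k) x + lookup d x + o x  ≡⟨ cong (_+ o x) (lookup-+ᵛ (shift t k) d x) ⟨
    lookup (shift t k +ᵛ d) x + o x          ∎)
    where
    open ≡-Reasoning
    o i : Loc → ℕ
    o x = factor t * out x (ruleOf t)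
    i x = factor t * into x (ruleOf t)
    swap : ∀ a b c → a + b + c ≡ a + c + b
    swap = solve-∀

  feasible-offset : ∀ {c k} τ d → Feasible c k τ → Feasible (c ⊕ d) (k +ᵛ d) τ
  feasible-offset []      d _         = tt
  feasible-offset (t ∷ τ) d (s , fea) = safe-offset t d s ,
    subst (λ k → Feasible _ k τ) (sym (shift-offset t d s)) (feasible-offset τ d fea)

  shifts-offset : ∀ {c k} τ d → Feasible c k τ → shifts τ (k +ᵛ d) ≡ shifts τ k +ᵛ d
  shifts-offset []      d _         = refl
  shifts-offset (t ∷ τ) d (s , fea) =
    trans (cong (shifts τ) (shift-offset t d s)) (shifts-offset τ d fea)

  -- Representing a schedule by another one

  gain : Fin nΓ → RuleId → ℕ
  gain i r = lookup (update r) i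

  rules : Schedule → List RuleId
  rules = map ruleOf

  -- The final counters are compared directly and not through `SameSums`, because draining a loop
  -- may change the totals of its rules. The inclusion of rules lets `τ′` inherit the guards known
  -- to hold for `τ`.
  record Rep (c : Reserve) (k : Counters) (τ τ′ : Schedule) : Set where
    constructor rep
    field
      feasible  : Feasible c k τ′
      same-end  : shifts τ′ k ≡ shifts τ k
      same-gain : ∀ i → wsum (gain i) τ′ ≡ wsum (gain i) τ
      rules-⊆   : rules τ′ ⊆ rules τ
  open Rep

  rep-refl : ∀ {c k τ} → Feasible c k τ → Rep c k τ τ
  rep-refl fea = rep fea refl (λ _ → refl) id

  rep-trans : ∀ {c k τ₁ τ₂ τ₃} → Rep c k τ₁ τ₂ → Rep c k τ₂ τ₃ → Rep c k τ₁ τ₃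
  rep-trans R S = rep (feasible S) (trans (same-end S) (same-end R))
    (λ i → trans (same-gain S i) (same-gain R i)) (rules-⊆ R ∘ rules-⊆ S)

  rep-++ˡ : ∀ {c k} υ {τ τ′} → Feasible c k υ → Rep c (shifts υ k) τ τ′ → Rep c k (υ ++ τ) (υ ++ τ′)
  rep-++ˡ {k = k} υ {τ} {τ′} fea R = rep
    (feasible-++⁺ υ fea (feasible R))
    (trans (shifts-++ υ τ′ k) (trans (same-end R) (sym (shifts-++ υ τ k))))
    (λ i → trans (∑-++ _ υ τ′) (trans (cong (wsum (gain i) υ +_) (same-gain R i)) (sym (∑-++ _ υ τ))))
    (subst₂ _⊆_ (sym (map-++ ruleOf υ τ′)) (sym (map-++ ruleOf υ τ))
            (Subset.++⁺ʳ (rules υ) (rules-⊆ R)))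

  rep-++ʳ : ∀ {c k} υ {τ τ′} → Rep c k τ τ′ → Feasible c (shifts τ k) υ → Rep c k (τ ++ υ) (τ′ ++ υ)
  rep-++ʳ {c} {k} υ {τ} {τ′} R fea = rep
    (feasible-++⁺ τ′ (feasible R) (subst (λ k → Feasible c k υ) (sym (same-end R)) fea))
    (trans (shifts-++ τ′ υ k) (trans (cong (shifts υ) (same-end R)) (sym (shifts-++ τ υ k))))
    (λ i → trans (∑-++ _ τ′ υ) (trans (cong (_+ wsum (gain i) υ) (same-gain R i)) (sym (∑-++ _ τ υ))))
    (subst₂ _⊆_ (sym (map-++ ruleOf τ′ υ)) (sym (map-++ ruleOf τ υ))
            (Subset.++⁺ˡ (rules υ) (rules-⊆ R)))

  rep-sums : ∀ {c k τ τ′} → Feasible c k τ → Feasible c k τ′ → SameSums τ′ τ → rules τ′ ⊆ rules τ →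
    Rep c k τ τ′
  rep-sums {τ = τ} {τ′} fea fea′ sums ⊆ = rep fea′ (shifts-determined τ′ τ fea′ fea sums) (sums ∘ gain) ⊆

  -- Swapping and merging

  shift-≤ : ∀ {c k x} t → Safe c k t → to (ruleOf t) ≢ x → lookup (shift t k) x ≤ lookup k x
  shift-≤ {k = k} {x} t s to≢ = begin
    lookup (shift t k) x                               ≤⟨ ℕ.m≤m+n _ _ ⟩
    lookup (shift t k) x + factor t * out x (ruleOf t) ≡⟨ shift-balance t s x ⟩
    lookup k x + factor t * into x (ruleOf t)          ≡⟨ cong (lookup k x +_) (*-δ-≢ (factor t) to≢) ⟩
    lookup k x + 0                                     ≡⟨ ℕ.+-identityʳ _ ⟩
    lookup k x                                         ∎
    where open ℕ.≤-Reasoning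

  -- As `t₁` does not feed the source of `t₂`, the counter there was at least as large before `t₁`.
  -- Conversely, `t₂` lowers the source of `t₁` only if both leave the same location, which then
  -- holds both factors and the reserve.
  safe-swap : ∀ {c k} t₁ t₂ → to (ruleOf t₁) ≢ from (ruleOf t₂) →
    Safe c k t₁ → Safe c (shift t₁ k) t₂ → Safe c k t₂ × Safe c (shift t₂ k) t₁
  safe-swap {c} {k} t₁ t₂ to≢from s₁ s₂ =
    go (selfLoop? (ruleOf t₁)) (selfLoop? (ruleOf t₂)) (from (ruleOf t₂) Fin.≟ from (ruleOf t₁)) s₁ s₂
    where
    go : Dec (SelfLoop (ruleOf t₁)) → Dec (SelfLoop (ruleOf t₂)) →
      Dec (from (ruleOf t₂) ≡ from (ruleOf t₁)) →
      Safe c k t₁ → Safe c (shift t₁ k) t₂ → Safe c k t₂ × Safe c (shift t₂ k) t₁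
    go (yes self₁) _ _ _ s₂ = subst (λ k → Safe c k t₂) (shift-self t₁ k self₁) s₂ , idle self₁
    go _ (yes self₂) _ s₁ _ = idle self₂ , subst (λ k → Safe c k t₁) (sym (shift-self t₂ k self₂)) s₁
    go (no ¬self₁) _ _ (idle self₁) _ = contradiction self₁ ¬self₁
    go _ (no ¬self₂) _ _ (idle self₂) = contradiction self₂ ¬self₂
    go (no ¬self₁) (no ¬self₂) (no ne) (able le₁) (able le₂) =
      s₂′ , able (ℕ.≤-trans le₁ (shift-other-≥ t₂ s₂′ ne))
      where
      s₂′ : Safe c k t₂
      s₂′ = able (ℕ.≤-trans le₂ (shift-≤ t₁ s₁ to≢from))
    go (no ¬self₁) (no ¬self₂) (yes eq) (able le₁) (able le₂) = s₂′ , able (ℕ.+-cancelˡ-≤ f₂ _ _ (begin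
      f₂ + (f₁ + c ℓ₁)             ≡⟨ rearrange f₂ f₁ (c ℓ₁) ⟩
      f₂ + c ℓ₁ + f₁               ≤⟨ ℕ.+-monoˡ-≤ f₁ (subst (λ ℓ → f₂ + c ℓ ≤ lookup (shift t₁ k) ℓ) eq le₂) ⟩
      lookup (shift t₁ k) ℓ₁ + f₁  ≡⟨ shift-from t₁ ¬self₁ s₁ ⟩
      lookup k ℓ₁                  ≡⟨ subst (λ ℓ → lookup (shift t₂ k) ℓ + f₂ ≡ lookup k ℓ) eq (shift-from t₂ ¬self₂ s₂′) ⟨
      lookup (shift t₂ k) ℓ₁ + f₂  ≡⟨ ℕ.+-comm _ f₂ ⟩
      f₂ + lookup (shift t₂ k) ℓ₁  ∎))
      where
      open ℕ.≤-Reasoning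
      f₁ = factor t₁
      f₂ = factor t₂
      ℓ₁ = from (ruleOf t₁)
      s₂′ : Safe c k t₂
      s₂′ = able (ℕ.≤-trans le₂ (shift-≤ t₁ s₁ to≢from))
      rearrange : ∀ a b c → a + (b + c) ≡ a + c + b
      rearrange = solve-∀

  safe-merge : ∀ {c k} t u → ruleOf t ≡ ruleOf u → Safe c k t → Safe c (shift t k) u →
    Safe c k ⟨ ruleOf t , factor t + factor u ⟩
  safe-merge {c} {k} t ⟨ _ , f ⟩ refl s s′ = go (selfLoop? (ruleOf t)) s′
    where
    go : Dec (SelfLoop (ruleOf t)) → Safe c (shift t k) ⟨ ruleOf t , f ⟩ → Safe c k ⟨ ruleOf t , factor t + f ⟩
    go (yes self) _           = idle self
    go (no ¬self) (idle self) = contradiction self ¬self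
    go (no ¬self) (able le)   = able (begin
      factor t + f + c (from (ruleOf t))                    ≡⟨ ℕ.+-assoc (factor t) f _ ⟩
      factor t + (f + c (from (ruleOf t)))                  ≤⟨ ℕ.+-monoʳ-≤ (factor t) le ⟩
      factor t + lookup (shift t k) (from (ruleOf t))       ≡⟨ ℕ.+-comm (factor t) _ ⟩
      lookup (shift t k) (from (ruleOf t)) + factor t       ≡⟨ shift-from t ¬self s ⟩
      lookup k (from (ruleOf t))                            ∎)
      where open ℕ.≤-Reasoning

  rep-pushMerge : ∀ {c k} t τ → Feasible c k (t ∷ τ) → Rep c k (t ∷ τ) (pushMerge t τ)
  rep-pushMerge t []      fea = rep-refl fea
  rep-pushMerge t (u ∷ τ) fea@(s , s′ , fea′) with ruleOf t Fin.≟ ruleOf u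
  ... | no  _  = rep-refl fea
  ... | yes eq = rep-++ʳ τ {t ∷ u ∷ []} (rep-sums (s , s′ , tt) (safe-merge t u eq s s′ , tt) sums (λ { (here refl) → here refl })) fea′
    where
    sums : SameSums [ ⟨ ruleOf t , factor t + factor u ⟩ ] (t ∷ u ∷ [])
    sums w rewrite sym eq = distrib (factor t) (factor u) (w (ruleOf t))
      where
      distrib : ∀ a b x → (a + b) * x + 0 ≡ a * x + (b * x + 0)
      distrib = solve-∀

  rep-merge : ∀ {c k} τ → Feasible c k τ → Rep c k τ (merge τ)
  rep-merge []      _         = rep-refl tt
  rep-merge (t ∷ τ) (s , fea) = rep-trans R (rep-pushMerge t (merge τ) (feasible R))
    where R = rep-++ˡ [ t ] (s , tt) (rep-merge τ fea)

  all-pushMerge : ∀ {P : RuleId → Set} t τ → P (ruleOf t) → All (P ∘ ruleOf) τ →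
    All (P ∘ ruleOf) (pushMerge t τ)
  all-pushMerge t []      p []       = p ∷ []
  all-pushMerge t (u ∷ τ) p (q ∷ qs) with ruleOf t Fin.≟ ruleOf u
  ... | yes _ = p ∷ qs
  ... | no  _ = p ∷ q ∷ qs

  all-merge : ∀ {P : RuleId → Set} {τ} → All (P ∘ ruleOf) τ → All (P ∘ ruleOf) (merge τ)
  all-merge []       = []
  all-merge (p ∷ ps) = all-pushMerge _ _ p (all-merge ps)

  -- Occurrences of rules, and sorting by rule class

  count : RuleId → Schedule → ℕ
  count r = ∑ (λ t → δ (ruleOf t) r)

  count-∉ : ∀ {r τ} → All (λ t → ruleOf t ≢ r) τ → count r τ ≡ 0
  count-∉ = ∑-zero ∘ All.map δ-≢

  module Order (lin : LinearExtension) where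
    open LinearExtension lin
    open IsStrictTotalOrder isStrictTotalOrder using (compare; irrefl; <-respʳ-≈; module Eq)
      renaming (trans to ≺lin-trans)
    open Swapping lin

    -- If `r₁` led into the source of `r₂`, its class would equal or precede that of `r₂`, against
    -- the order assumed. This makes every swap legal.
    ≺lin⇒to≢from : ∀ {r₁ r₂} → r₂ ≺lin r₁ → to r₁ ≢ from r₂
    ≺lin⇒to≢from {r₁} {r₂} lt eq with compare r₁ r₂
    ... | tri< lt′ _ _ = asym lt lt′
    ... | tri≈ _ r₁∼r₂ _ = irrefl (Eq.sym r₁∼r₂) lt
    ... | tri> _ r₁≁r₂ _ = asym lt (extends (r₁ , r₂ , Eq.refl , Eq.refl , TransClosure.[ eq ] , r₁≁r₂))

    rep-swap : ∀ {c k τ τ′} → τ ⟶ τ′ → Feasible c k τ → Rep c k τ τ′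
    rep-swap {τ = t₁ ∷ t₂ ∷ τ} (here lt) (s₁ , s₂ , fea) with safe-swap t₁ t₂ (≺lin⇒to≢from lt) s₁ s₂
    ... | s₂′ , s₁′ = rep-++ʳ τ {t₁ ∷ t₂ ∷ []} (rep-sums (s₁ , s₂ , tt) (s₂′ , s₁′ , tt) sums
      (λ { (here refl) → there (here refl) ; (there (here refl)) → here refl })) fea
      where
      sums : SameSums (t₂ ∷ t₁ ∷ []) (t₁ ∷ t₂ ∷ [])
      sums w = comm (factor t₂ * w (ruleOf t₂)) (factor t₁ * w (ruleOf t₁))
        where
        comm : ∀ a b → a + (b + 0) ≡ b + (a + 0)
        comm = solve-∀
    rep-swap {τ = t ∷ τ} (there st) (s , fea) = rep-++ˡ [ t ] (s , tt) (rep-swap st fea)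

    rep-swaps : ∀ {c k τ τ′} → Star _⟶_ τ τ′ → Feasible c k τ → Rep c k τ τ′
    rep-swaps ε         fea = rep-refl fea
    rep-swaps (st ◅ sts) fea = rep-trans R (rep-swaps sts (feasible R))
      where R = rep-swap st fea

    infix 4 _≼_
    -- The total preorder of the classes, as a negated strict order: this is what remains when no
    -- swap applies, and its symmetric part is `_∼P_`.
    _≼_ : Transition → Transition → Set
    t ≼ u = ¬ ruleOf u ≺lin ruleOf t

    ≼-refl : ∀ {t} → t ≼ t
    ≼-refl = irrefl Eq.refl

    ≼-trans : ∀ {t u v} → t ≼ u → u ≼ v → t ≼ v
    ≼-trans {t} {u} t≼u u≼v v≺t with compare (ruleOf u) (ruleOf t)
    ... | tri< u≺t _ _ = t≼u u≺t
    ... | tri≈ _ u∼t _ = u≼v (<-respʳ-≈ (Eq.sym u∼t) v≺t)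
    ... | tri> _ _ t≺u = u≼v (≺lin-trans v≺t t≺u)

    ≼-antisym : ∀ {t u} → t ≼ u → u ≼ t → ruleOf t ∼P ruleOf u
    ≼-antisym {t} {u} t≼u u≼t with compare (ruleOf t) (ruleOf u)
    ... | tri< t≺u _ _ = contradiction t≺u u≼t
    ... | tri≈ _ t∼u _ = t∼u
    ... | tri> _ _ u≺t = contradiction u≺t t≼u

    ∼P⇒≼ : ∀ {t u} → ruleOf t ∼P ruleOf u → t ≼ u
    ∼P⇒≼ t∼u = irrefl (Eq.sym t∼u)

    Sorted : Schedule → Set
    Sorted = AllPairs _≼_

    all-sink : ∀ {P : Transition → Set} t τ → P t → All P τ → All P (sink t τ)
    all-sink t []      p []       = p ∷ []
    all-sink t (u ∷ τ) p (q ∷ qs) with does (ruleOf u <? ruleOf t)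
    ... | true  = q ∷ all-sink t τ p qs
    ... | false = p ∷ q ∷ qs

    sink-sorted : ∀ t τ → Sorted τ → Sorted (sink t τ)
    sink-sorted t []      []             = [] ∷ []
    sink-sorted t (u ∷ τ) (u≼τ ∷ sorted) with ruleOf u <? ruleOf t
    ... | yes u≺t = all-sink t τ (asym u≺t) u≼τ ∷ sink-sorted t τ sorted
    ... | no  t≼u = (t≼u ∷ All.map (λ {v} → ≼-trans {t} {u} {v} t≼u) u≼τ) ∷ u≼τ ∷ sorted

    swapAll-sorted : ∀ τ → Sorted (swapAll τ)
    swapAll-sorted []      = []
    swapAll-sorted (t ∷ τ) = sink-sorted t (swapAll τ) (swapAll-sorted τ)

    pushMerge-sorted : ∀ t τ → Sorted (t ∷ τ) → Sorted (pushMerge t τ)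
    pushMerge-sorted t []      sorted = sorted
    pushMerge-sorted t (u ∷ τ) sorted@((_ ∷ t≼τ) ∷ _ ∷ sorted′) with ruleOf t Fin.≟ ruleOf u
    ... | yes _ = t≼τ ∷ sorted′
    ... | no  _ = sorted

    merge-cons-sorted : ∀ {t τ} → Sorted (t ∷ τ) → Sorted (t ∷ merge τ)
    merge-sorted : ∀ {τ} → Sorted τ → Sorted (merge τ)
    merge-cons-sorted (t≼τ ∷ sorted) = all-merge t≼τ ∷ merge-sorted sorted
    merge-sorted []                 = []
    merge-sorted sorted@(_ ∷ _)     = pushMerge-sorted _ _ (merge-cons-sorted sorted)

    -- A rule off all cycles is alone in its class, so sorting makes its occurrences adjacent: a
    -- different rule between two of them would be squeezed into the same class. Adjacent
    -- occurrences are merged.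
    pushMerge-count : ∀ {r} t τ → ¬ OnCycle r → Sorted (t ∷ τ) → count r τ ≤ 1 → count r (pushMerge t τ) ≤ 1
    pushMerge-count {r} t [] _ _ _ with ruleOf t Fin.≟ r
    ... | yes _ = ℕ.≤-refl
    ... | no  _ = z≤n
    pushMerge-count {r} t (u ∷ τ) acyclic (t≼ ∷ u≼ ∷ _) le with ruleOf t Fin.≟ ruleOf u
    ... | yes eq = subst (λ s → δ s r + count r τ ≤ 1) (sym eq) le
    ... | no  ne with ruleOf t Fin.≟ r
    ...   | no  _    = le
    ...   | yes refl = ℕ.≤-reflexive (cong suc (count-∉ {ruleOf t} {u ∷ τ} ((ne ∘ sym) ∷ All.map (λ {v} → distinct {v}) u≼)))
      where
      distinct : ∀ {v} → u ≼ v → ruleOf v ≢ ruleOf t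
      distinct u≼v refl with ≼-antisym {t} {u} (All.head t≼) u≼v
      ... | inj₁ (t≺u , u≺t) = acyclic (≺P⁺-onCycle (Trans._++_ t≺u u≺t))
      ... | inj₂ eq          = ne eq

    merge-count : ∀ {r τ} → ¬ OnCycle r → Sorted τ → count r (merge τ) ≤ 1
    merge-count acyclic []             = z≤n
    merge-count acyclic s@(_ ∷ sorted) =
      pushMerge-count _ _ acyclic (merge-cons-sorted s) (merge-count acyclic sorted)

  -- The schedule of a loop

  dropZero : Schedule → Schedule
  dropZero = filter (λ t → ¬? (factor t ℕ.≟ 0))

  shift-zero : ∀ {c k} t → Safe c k t → factor t ≡ 0 → shift t k ≡ k
  shift-zero {k = k} ⟨ r , .0 ⟩ s refl = vec-ext λ x →
    ℕ.+-cancelʳ-≡ 0 (lookup (shift ⟨ r , 0 ⟩ k) x) _ (shift-balance ⟨ r , 0 ⟩ s x)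

  feasible-dropZero : ∀ {c k} τ → Feasible c k τ → Feasible c k (dropZero τ)
  feasible-dropZero []                  _         = tt
  feasible-dropZero (⟨ r , suc f ⟩ ∷ τ) (s , fea) = s , feasible-dropZero τ fea
  feasible-dropZero {c} (⟨ r , zero ⟩ ∷ τ) (s , fea) =
    subst (λ k → Feasible c k (dropZero τ)) (shift-zero ⟨ r , zero ⟩ s refl) (feasible-dropZero τ fea)

  shifts-dropZero : ∀ {c k} τ → Feasible c k τ → shifts (dropZero τ) k ≡ shifts τ k
  shifts-dropZero []                  _         = refl
  shifts-dropZero (⟨ r , suc f ⟩ ∷ τ) (s , fea) = shifts-dropZero τ fea
  shifts-dropZero (⟨ r , zero ⟩ ∷ τ)  (s , fea) =
    trans (cong (shifts (dropZero τ)) (sym (shift-zero ⟨ r , zero ⟩ s refl))) (shifts-dropZero τ fea)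

  shifts-self : ∀ {k} τ → All (SelfLoop ∘ ruleOf) τ → shifts τ k ≡ k
  shifts-self []      []             = refl
  shifts-self (t ∷ τ) (self ∷ selfs) = trans (cong (shifts τ) (shift-self t _ self)) (shifts-self τ selfs)

  ∑-shift : ∀ {c k} t xs → Safe c k t →
    ∑ (lookup (shift t k)) xs + factor t * ∑ (δ (from (ruleOf t))) xs
    ≡ ∑ (lookup k) xs + factor t * ∑ (δ (to (ruleOf t))) xs
  ∑-shift {k = k} t xs s = begin
    ∑ k₁ xs + f * ∑ o xs          ≡⟨ cong (∑ k₁ xs +_) (∑-* f o xs) ⟨
    ∑ k₁ xs + ∑ (λ x → f * o x) xs ≡⟨ ∑-+ k₁ (λ x → f * o x) xs ⟨
    ∑ (λ x → k₁ x + f * o x) xs   ≡⟨ ∑-cong (All.universal (shift-balance t s) xs) ⟩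
    ∑ (λ x → k₀ x + f * i x) xs   ≡⟨ ∑-+ k₀ (λ x → f * i x) xs ⟩
    ∑ k₀ xs + ∑ (λ x → f * i x) xs ≡⟨ cong (∑ k₀ xs +_) (∑-* f i xs) ⟩
    ∑ k₀ xs + f * ∑ i xs          ∎
    where
    open ≡-Reasoning
    k₀ k₁ o i : Loc → ℕ
    k₀ = lookup k
    k₁ = lookup (shift t k)
    o  = δ (from (ruleOf t))
    i  = δ (to (ruleOf t))
    f  = factor t

  ∑-shifts : ∀ {c k xs} τ → Feasible c k τ → Unique xs →
    All (λ t → from (ruleOf t) ∈ xs × to (ruleOf t) ∈ xs) τ →
    ∑ (lookup (shifts τ k)) xs ≡ ∑ (lookup k) xs
  ∑-shifts []      _ _ [] = refl
  ∑-shifts {k = k} {xs} (t ∷ τ) (s , fea) uniq ((from∈ , to∈) ∷ inside) =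
    trans (∑-shifts τ fea uniq inside) (ℕ.+-cancelʳ-≡ (factor t * 1) _ _ (begin
      ∑ (lookup (shift t k)) xs + factor t * 1                            ≡⟨ cong (λ n → ∑ (lookup (shift t k)) xs + factor t * n) (∑-δ uniq from∈) ⟨
      ∑ (lookup (shift t k)) xs + factor t * ∑ (δ (from (ruleOf t))) xs   ≡⟨ ∑-shift t xs s ⟩
      ∑ (lookup k) xs + factor t * ∑ (δ (to (ruleOf t))) xs               ≡⟨ cong (λ n → ∑ (lookup k) xs + factor t * n) (∑-δ uniq to∈) ⟩
      ∑ (lookup k) xs + factor t * 1                                      ∎))
    where open ≡-Reasoning

  drain-rules : ∀ m rs σ → rules (drain m rs σ) ≡ rs
  drain-rules m []       σ = refl
  drain-rules m (r ∷ rs) σ = cong (r ∷_) (drain-rules m rs _)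

  all-drain : ∀ {P : RuleId → Set} {m rs} σ → All P rs → All (P ∘ ruleOf) (drain m rs σ)
  all-drain σ []       = []
  all-drain σ (p ∷ ps) = p ∷ all-drain _ ps

  -- A counter below its target gives factor 0, and then `c ≤ k` alone is enough; so feasibility
  -- holds whether or not the subtraction truncates.
  drain-safe : ∀ {k m c} → c ≤ m → c ≤ k → k ∸ m + c ≤ k
  drain-safe {k} {m} {c} c≤m c≤k with ℕ.≤-total m k
  ... | inj₁ m≤k = ℕ.≤-trans (ℕ.+-monoʳ-≤ (k ∸ m) c≤m) (ℕ.≤-reflexive (ℕ.m∸n+n≡m m≤k))
  ... | inj₂ k≤m rewrite ℕ.m≤n⇒m∸n≡0 k≤m = c≤k

  drain-feasible : ∀ {c m} rs σ → (∀ ℓ → c ℓ ≤ m ℓ) → c ≤ᵏ κ σ → Feasible c (κ σ) (drain m rs σ)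
  drain-feasible             []       σ c≤m c≤κ = tt
  drain-feasible {c} {m} (r ∷ rs) σ c≤m c≤κ = s , drain-feasible rs (fire t σ) c≤m (shift-≥ t s c≤κ)
    where
    t = ⟨ r , lookup (κ σ) (from r) ∸ m (from r) ⟩
    s : Safe c (κ σ) t
    s = able (drain-safe (c≤m (from r)) (c≤κ (from r)))

  drain-feasible₀ : ∀ {m} rs σ → Feasible (λ _ → 0) (κ σ) (drain m rs σ)
  drain-feasible₀ rs σ = drain-feasible rs σ (λ _ → z≤n) (λ _ → z≤n)

  -- The bound holds as soon as the rule leaving `x` has fired. No later rule enters `x`: its target
  -- is a later source or the endpoint of the walk, hence the exception for `ℓ′`.
  drain-≤ : ∀ {m ℓ ℓ′ x} rs σ → Walk ℓ rs ℓ′ → Unique (map from rs) → All (¬_ ∘ SelfLoop) rs →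
    x ∈ map from rs → x ≢ ℓ′ → lookup (shifts (drain m rs σ) (κ σ)) x ≤ m x
  drain-≤ {m} {ℓ′ = ℓ′} (r ∷ rs) σ (_ , w) (r∉ ∷ uniq) (¬self ∷ _) (here refl) x≢ℓ′
    with s , fea ← drain-feasible₀ {m} (r ∷ rs) σ = begin
      lookup (shifts (drain m rs (fire t σ)) (shift t (κ σ))) x ≡⟨ shifts-untouched (drain m rs (fire t σ)) fea
                                                                     (all-drain (fire t σ) (All.tabulate untouched)) ⟩
      lookup (shift t (κ σ)) x                                  ≤⟨ ℕ.+-cancelʳ-≤ f _ _ (begin
        lookup (shift t (κ σ)) x + f                              ≡⟨ shift-from t ¬self s ⟩
        lookup (κ σ) x                                            ≤⟨ ℕ.m≤n+m∸n (lookup (κ σ) x) (m x) ⟩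
        m x + f                                                   ∎) ⟩
      m x                                                       ∎
    where
    open ℕ.≤-Reasoning
    x = from r
    f = lookup (κ σ) x ∸ m x
    t = ⟨ r , f ⟩
    untouched : ∀ {u} → u ∈ rs → from u ≢ x × to u ≢ x
    untouched {u} u∈ = ≢-sym (All.lookup r∉ (∈-map⁺ from u∈)) , λ to≡ → case walk-to rs w u∈ of λ
      { (inj₁ to∈) → All.lookup r∉ to∈ (sym to≡) ; (inj₂ to≡ℓ′) → x≢ℓ′ (trans (sym to≡) to≡ℓ′) }
  drain-≤ (r ∷ rs) σ (_ , w) (_ ∷ uniq) (_ ∷ ¬selfs) (there x∈) x≢ℓ′ =
    drain-≤ rs (fire _ σ) w uniq ¬selfs x∈ x≢ℓ′

  -- Only the first location may exceed its target, and the total is right; so each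
  -- location in turn passes on the excess, and nothing is left to leave the last one.
  drain-exact : ∀ {e ℓ ℓ′} r rs σ → Walk ℓ (r ∷ rs) ℓ′ → Unique (map from (r ∷ rs)) →
    All (¬_ ∘ SelfLoop) (r ∷ rs) → ∑ (lookup (κ σ)) (map from (r ∷ rs)) ≡ ∑ e (map from (r ∷ rs)) →
    All (λ x → lookup (κ σ) x ≤ e x) (map from rs) →
    let k = shifts (drain e (r ∷ rs) σ) (κ σ) in
    (∀ {x} → x ∈ map from (r ∷ rs) → lookup k x ≡ e x)
    × (∀ {x} → x ∉ map from (r ∷ rs) → lookup k x ≡ lookup (κ σ) x)
  drain-exact {e} r [] σ _ _ _ sums [] =
    (λ { (here refl) → trans (cong (λ k → lookup k (from r)) still) start≡e }) ,
    (λ {x} _ → cong (λ k → lookup k x) still)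
    where
    start≡e : lookup (κ σ) (from r) ≡ e (from r)
    start≡e = ℕ.+-cancelʳ-≡ 0 _ _ sums
    still : shift ⟨ r , lookup (κ σ) (from r) ∸ e (from r) ⟩ (κ σ) ≡ κ σ
    still = shift-zero _ (proj₁ (drain-feasible₀ {e} [ r ] σ))
      (ℕ.m≤n⇒m∸n≡0 (ℕ.≤-reflexive start≡e))
  drain-exact {e} r (r′ ∷ rs) σ (_ , w@(next , _)) (r∉ ∷ uniq@(r′∉ ∷ _)) (¬self ∷ ¬selfs) sums les@(_ ∷ les′) =
    (λ { (here refl)  → trans (outside (λ x∈ → All.lookup r∉ x∈ refl)) source
       ; (there x∈) → inside x∈ }) ,
    (λ {x} x∉ → trans (outside (x∉ ∘ there)) (shift-untouched t s
      (λ eq → x∉ (here (sym eq))) (λ eq → x∉ (there (here (trans (sym eq) (sym next)))))))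
    where
    open ≡-Reasoning
    ℓ  = from r
    xs = map from (r′ ∷ rs)
    f  = lookup (κ σ) ℓ ∸ e ℓ
    t  = ⟨ r , f ⟩
    k₀ = lookup (κ σ)
    k₁ = lookup (shift t (κ σ))

    s : Safe (λ _ → 0) (κ σ) t
    s = proj₁ (drain-feasible₀ {e} (r ∷ r′ ∷ rs) σ)

    -- No truncation in f: as xs has at most its target counters, ℓ has at least its own.
    e≤k₀ : e ℓ ≤ k₀ ℓ
    e≤k₀ = ℕ.+-cancelʳ-≤ (∑ k₀ xs) _ _
      (ℕ.≤-trans (ℕ.+-monoʳ-≤ (e ℓ) (∑-mono les)) (ℕ.≤-reflexive (sym sums)))

    f+≡ : f + ∑ k₀ xs ≡ ∑ e xs
    f+≡ = ℕ.+-cancelˡ-≡ (e ℓ) _ _ (begin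
      e ℓ + (f + ∑ k₀ xs) ≡⟨ ℕ.+-assoc (e ℓ) f _ ⟨
      e ℓ + f + ∑ k₀ xs   ≡⟨ cong (_+ ∑ k₀ xs) (ℕ.m+[n∸m]≡n e≤k₀) ⟩
      k₀ ℓ + ∑ k₀ xs      ≡⟨ sums ⟩
      e ℓ + ∑ e xs        ∎)

    source : k₁ ℓ ≡ e ℓ
    source = ℕ.+-cancelʳ-≡ f _ _ (trans (shift-from t ¬self s) (sym (ℕ.m+[n∸m]≡n e≤k₀)))

    unaffected : ∀ {x} → x ∈ map from rs → k₁ x ≡ k₀ x
    unaffected x∈ = shift-untouched t s (All.lookup r∉ (there x∈))
      (λ eq → All.lookup r′∉ x∈ (trans next eq))

    rest = drain-exact {e} r′ rs (fire t σ) w uniq ¬selfs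
      (begin
        ∑ k₁ xs                      ≡⟨ ℕ.+-identityʳ _ ⟨
        ∑ k₁ xs + 0                  ≡⟨ cong (∑ k₁ xs +_) (trans (cong (f *_) (∑-zero (All.map δ-≢ r∉))) (ℕ.*-zeroʳ f)) ⟨
        ∑ k₁ xs + f * ∑ (δ ℓ) xs     ≡⟨ ∑-shift t xs s ⟩
        ∑ k₀ xs + f * ∑ (δ (to r)) xs ≡⟨ cong (∑ k₀ xs +_) (trans (cong (f *_) (∑-δ uniq (here (sym next)))) (ℕ.*-identityʳ f)) ⟩
        ∑ k₀ xs + f                  ≡⟨ ℕ.+-comm _ f ⟩
        f + ∑ k₀ xs                  ≡⟨ f+≡ ⟩
        ∑ e xs                       ∎)
      (All.tabulate (λ {x} x∈ → ℕ.≤-trans (ℕ.≤-reflexive (unaffected x∈)) (All.lookup les′ x∈)))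
    inside  = proj₁ rest
    outside = proj₂ rest

  totals : Schedule → List RuleId → Schedule
  totals τ = map (λ r → ⟨ r , totalFactor r τ ⟩)

  totalFactor-∷ : ∀ r t τ → totalFactor r (t ∷ τ) ≡ δ (ruleOf t) r * factor t + totalFactor r τ
  totalFactor-∷ r t τ with ruleOf t Fin.≟ r
  ... | yes _ = cong (_+ totalFactor r τ) (sym (ℕ.*-identityˡ (factor t)))
  ... | no  _ = refl

  totalFactor-∉ : ∀ r τ → r ∉ rules τ → totalFactor r τ ≡ 0
  totalFactor-∉ r []      _  = refl
  totalFactor-∉ r (t ∷ τ) r∉ = trans (totalFactor-∷ r t τ)
    (cong₂ _+_ (cong (_* factor t) (δ-≢ (λ eq → r∉ (here (sym eq))))) (totalFactor-∉ r τ (r∉ ∘ there)))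

  -- Interchange of summation: each transition of `τ` is picked up by exactly one rule of the
  -- duplicate-free list `rs`.
  wsum-totals : ∀ {rs} w τ → Unique rs → All (λ t → ruleOf t ∈ rs) τ → wsum w (totals τ rs) ≡ wsum w τ
  wsum-totals {rs} w τ uniq inside = trans (cong sum (sym (map-∘ rs))) (go τ inside)
    where
    go : ∀ τ → All (λ t → ruleOf t ∈ rs) τ → ∑ (λ r → totalFactor r τ * w r) rs ≡ wsum w τ
    go []      []            = ∑-zero (All.universal (λ _ → refl) rs)
    go (t ∷ τ) (t∈ ∷ inside) = begin
      ∑ (λ r → totalFactor r (t ∷ τ) * w r) rs
        ≡⟨ ∑-cong (All.universal (λ r → trans (cong (_* w r) (totalFactor-∷ r t τ))
                                                (distrib (δ (ruleOf t) r) (factor t) (totalFactor r τ) (w r))) rs) ⟩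
      ∑ (λ r → δ (ruleOf t) r * (factor t * w r) + totalFactor r τ * w r) rs
        ≡⟨ ∑-+ (λ r → δ (ruleOf t) r * (factor t * w r)) _ rs ⟩
      ∑ (λ r → δ (ruleOf t) r * (factor t * w r)) rs + ∑ (λ r → totalFactor r τ * w r) rs
        ≡⟨ cong₂ _+_ (∑-δ-∈ (λ r → factor t * w r) uniq t∈) (go τ inside) ⟩
      factor t * w (ruleOf t) + wsum w τ ∎
      where
      open ≡-Reasoning
      distrib : ∀ d f a b → (d * f + a) * b ≡ d * (f * b) + a * b
      distrib = solve-∀

  -- Firing along a simple walk, all inflow of a location arrives before its outflow.
  simpleWalk-feasible : ∀ {c k ℓ ℓ′} (F : RuleId → ℕ) rs → SimpleWalk ℓ rs ℓ′ →
    let τ = map (λ r → ⟨ r , F r ⟩) rs in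
    (∀ {s} → s ∈ rs → F s + c (from s) ≤ lookup k (from s) + wsum (into (from s)) τ) → Feasible c k τ
  simpleWalk-feasible F [] _ _ = tt
  simpleWalk-feasible {c} {k} {ℓ′ = ℓ′} F (r ∷ rs) simple@((_ , w) , r∉ ∷ uniq , ℓ′∉) enough =
    s , simpleWalk-feasible F rs (w , uniq , ℓ′∉ ∘ there) enough′
    where
    fires : List RuleId → Schedule
    fires = map (λ r → ⟨ r , F r ⟩)
    t = ⟨ r , F r ⟩

    to≢ : ∀ {u} → u ∈ r ∷ rs → to u ≢ from r
    to≢ (here refl) eq = All.head (simple-nonself (r ∷ rs) simple) (sym eq)
    to≢ (there u∈)  eq with walk-to rs w u∈
    ... | inj₁ to∈ = All.lookup r∉ to∈ (sym eq)
    ... | inj₂ to≡ = ℓ′∉ (here (trans (sym to≡) eq))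

    no-inflow : wsum (into (from r)) (fires (r ∷ rs)) ≡ 0
    no-inflow = ∑-zero {h = λ t → factor t * into (from r) (ruleOf t)} (All.map⁺ {f = λ r → ⟨ r , F r ⟩} (All.tabulate (λ {u} u∈ → *-δ-≢ (F u) (to≢ u∈))))

    s : Safe c k t
    s = able (ℕ.≤-trans (enough (here refl))
      (ℕ.≤-reflexive (trans (cong (lookup k (from r) +_) no-inflow) (ℕ.+-identityʳ _))))

    enough′ : ∀ {u} → u ∈ rs → F u + c (from u) ≤ lookup (shift t k) (from u) + wsum (into (from u)) (fires rs)
    enough′ {u} u∈ = begin
      F u + c (from u)                                                                    ≤⟨ enough (there u∈) ⟩
      lookup k (from u) + (F r * into (from u) r + wsum (into (from u)) (fires rs)) ≡⟨ ℕ.+-assoc (lookup k (from u)) _ _ ⟨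
      lookup k (from u) + F r * into (from u) r + wsum (into (from u)) (fires rs)   ≡⟨ cong (_+ wsum (into (from u)) (fires rs)) (shift-other t s (All.lookup r∉ (∈-map⁺ from u∈))) ⟨
      lookup (shift t k) (from u) + wsum (into (from u)) (fires rs)                       ∎
      where open ℕ.≤-Reasoning

  twoRounds-rules : ∀ L σ σ′ → rules (twoRounds L σ σ′) ≡ L ++ L
  twoRounds-rules L σ σ′ = trans (map-++ ruleOf round₁ _)
    (cong₂ _++_ (drain-rules _ L σ) (drain-rules _ L (run round₁ σ)))
    where round₁ = drain (λ ℓ → lookup (κ σ) ℓ ⊓ lookup (κ σ′) ℓ) L σ

  -- The reserve lies below both the start and the end counters, hence below their minimum, so the
  -- first round respects it. That round brings all locations but the first down to at most their
  -- end values; as the total over the loop is preserved, the situation is exactly the one that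
  -- `drain-exact` settles.
  twoRounds-correct : ∀ {c ℓ} r rs τ σ → Walk ℓ (r ∷ rs) ℓ → Unique (map from (r ∷ rs)) →
    All (¬_ ∘ SelfLoop) (r ∷ rs) → All (λ t → ruleOf t ∈ r ∷ rs) τ → c ≤ᵏ κ σ → Feasible c (κ σ) τ →
    let τ′ = twoRounds (r ∷ rs) σ (run τ σ) in
    Feasible c (κ σ) τ′ × shifts τ′ (κ σ) ≡ shifts τ (κ σ)
  twoRounds-correct {c} {ℓ} r rs τ σ w@(from≡ , _) uniq@(r∉ ∷ _) nonself inside c≤κ fea =
    feasible-++⁺ round₁ fea₁ (subst (λ k → Feasible c k round₂) κσ₁ fea₂) ,
    trans (shifts-++ round₁ round₂ (κ σ)) (trans (cong (shifts round₂) (sym κσ₁)) (vec-ext pointwise))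
    where
    L = r ∷ rs
    froms = map from L
    init end low : Loc → ℕ
    init  = lookup (κ σ)
    end   = lookup (κ (run τ σ))
    low x = init x ⊓ end x
    round₁ = drain low L σ
    σ₁     = run round₁ σ
    round₂ = drain end L σ₁

    κσ₁ : κ σ₁ ≡ shifts round₁ (κ σ)
    κσ₁ = κ-run round₁ σ

    c≤end : ∀ x → c x ≤ end x
    c≤end x = subst (λ k → c x ≤ lookup k x) (sym (κ-run τ σ)) (shifts-≥ τ fea c≤κ x)

    fea₁ : Feasible c (κ σ) round₁
    fea₁ = drain-feasible L σ (λ x → ℕ.⊓-glb (c≤κ x) (c≤end x)) c≤κ

    fea₂ : Feasible c (κ σ₁) round₂
    fea₂ = drain-feasible L σ₁ c≤end (subst (c ≤ᵏ_) (sym κσ₁) (shifts-≥ round₁ fea₁ c≤κ))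

    ends : ∀ {u} → u ∈ L → from u ∈ froms × to u ∈ froms
    ends u∈ = ∈-map⁺ from u∈ , closed-to L w u∈

    inside₁ : All (λ t → from (ruleOf t) ∈ froms × to (ruleOf t) ∈ froms) round₁
    inside₁ = all-drain σ (All.tabulate ends)

    sums : ∑ (lookup (κ σ₁)) froms ≡ ∑ end froms
    sums = begin
      ∑ (lookup (κ σ₁)) froms               ≡⟨ cong (λ k → ∑ (lookup k) froms) κσ₁ ⟩
      ∑ (lookup (shifts round₁ (κ σ))) froms ≡⟨ ∑-shifts round₁ fea₁ uniq inside₁ ⟩
      ∑ init froms                           ≡⟨ ∑-shifts τ fea uniq (All.map ends inside) ⟨
      ∑ (lookup (shifts τ (κ σ))) froms      ≡⟨ cong (λ k → ∑ (lookup k) froms) (κ-run τ σ) ⟨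
      ∑ end froms                            ∎
      where open ≡-Reasoning

    below : All (λ x → lookup (κ σ₁) x ≤ end x) (map from rs)
    below = All.tabulate λ {x} x∈ → begin
      lookup (κ σ₁) x               ≡⟨ cong (λ k → lookup k x) κσ₁ ⟩
      lookup (shifts round₁ (κ σ)) x ≤⟨ drain-≤ L σ w uniq nonself (there x∈)
                                         (λ eq → All.lookup r∉ x∈ (trans from≡ (sym eq))) ⟩
      low x                          ≤⟨ ℕ.m⊓n≤n (init x) (end x) ⟩
      end x                          ∎
      where open ℕ.≤-Reasoning

    exact = drain-exact r rs σ₁ w uniq nonself sums below

    untouched : ∀ {x u} → x ∉ froms → from u ∈ froms × to u ∈ froms → from u ≢ x × to u ≢ x
    untouched x∉ (from∈ , to∈) = (λ { refl → x∉ from∈ }) , (λ { refl → x∉ to∈ })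

    pointwise : ∀ x → lookup (shifts round₂ (κ σ₁)) x ≡ lookup (shifts τ (κ σ)) x
    pointwise x with x ∈ℓ? froms
    ... | yes x∈ = trans (proj₁ exact x∈) (cong (λ k → lookup k x) (κ-run τ σ))
    ... | no  x∉ = begin
      lookup (shifts round₂ (κ σ₁)) x ≡⟨ proj₂ exact x∉ ⟩
      lookup (κ σ₁) x                 ≡⟨ cong (λ k → lookup k x) κσ₁ ⟩
      lookup (shifts round₁ (κ σ)) x  ≡⟨ shifts-untouched round₁ fea₁ (All.map (untouched x∉) inside₁) ⟩
      init x                         ≡⟨ shifts-untouched τ fea (All.map (untouched x∉ ∘ ends) inside) ⟨
      lookup (shifts τ (κ σ)) x       ∎
      where open ≡-Reasoning

  -- At each source, the total factor of its rule is part of the outflow of `τ`, and the reserve is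
  -- still there at the end. The balance of `τ` thus bounds their sum by the initial counter plus
  -- all inflow, which on a simple walk arrives first.
  simpleWalk-totals-correct : ∀ {c k ℓ ℓ′} rs τ → SimpleWalk ℓ rs ℓ′ → All (λ t → ruleOf t ∈ rs) τ →
    c ≤ᵏ k → Feasible c k τ → Feasible c k (totals τ rs) × shifts (totals τ rs) k ≡ shifts τ k
  simpleWalk-totals-correct {c} {k} rs τ simple@(_ , uniq , _) inside c≤k fea =
    fea′ , shifts-determined (totals τ rs) τ fea′ fea sums
    where
    sums : SameSums (totals τ rs) τ
    sums w = wsum-totals w τ (AllPairs.map (λ ne eq → ne (cong from eq)) (AllPairs.map⁻ uniq)) inside

    enough : ∀ {s} → s ∈ rs →
      totalFactor s τ + c (from s) ≤ lookup k (from s) + wsum (into (from s)) (totals τ rs)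
    enough {s} s∈ = begin
      totalFactor s τ + c x                    ≤⟨ ℕ.+-mono-≤ total≤out (shifts-≥ τ fea c≤k x) ⟩
      wsum (out x) τ + lookup (shifts τ k) x   ≡⟨ ℕ.+-comm (wsum (out x) τ) _ ⟩
      lookup (shifts τ k) x + wsum (out x) τ   ≡⟨ shifts-balance τ fea x ⟩
      lookup k x + wsum (into x) τ             ≡⟨ cong (lookup k x +_) (sums (into x)) ⟨
      lookup k x + wsum (into x) (totals τ rs) ∎
      where
      open ℕ.≤-Reasoning
      x = from s
      total≤out : totalFactor s τ ≤ wsum (out x) τ
      total≤out = begin
        totalFactor s τ               ≡⟨ *-δ-≡ (totalFactor s τ) {x} refl ⟨
        totalFactor s τ * out x s     ≤⟨ term-≤-∑ (λ t → factor t * out x (ruleOf t)) (∈-map⁺ (λ r → ⟨ r , totalFactor r τ ⟩) s∈) ⟩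
        wsum (out x) (totals τ rs)    ≡⟨ sums (out x) ⟩
        wsum (out x) τ                ∎

    fea′ : Feasible c k (totals τ rs)
    fea′ = simpleWalk-feasible (λ r → totalFactor r τ) rs simple enough

  -- Self-loops move nothing, so the start, current and end counters coincide and both rounds have
  -- nothing to drain. If `r` does not occur, no rule is left once it is cut out.
  trivialLoop-factors : ∀ {r} → SelfLoop r → ∀ σ τ → All (SelfLoop ∘ ruleOf) τ →
    All (λ t → factor t ≡ 0) (loopFactors [ r ] σ τ)
  trivialLoop-factors {r} self σ τ selfs with r ∈? rules τ
  ... | no  _ = []
  ... | yes _ = zero₁ ∷ zero₂ ∷ []
    where
    κ-end : κ (run τ σ) ≡ κ σ
    κ-end = trans (κ-run τ σ) (shifts-self τ selfs)
    t₁ = ⟨ r , lookup (κ σ) (from r) ∸ (lookup (κ σ) (from r) ⊓ lookup (κ (run τ σ)) (from r)) ⟩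

    zero₁ : factor t₁ ≡ 0
    zero₁ rewrite κ-end | ℕ.⊓-idem (lookup (κ σ) (from r)) = ℕ.n∸n≡0 (lookup (κ σ) (from r))

    zero₂ : lookup (κ (fire t₁ σ)) (from r) ∸ lookup (κ (run τ σ)) (from r) ≡ 0
    zero₂ = trans (cong₂ (λ k k′ → lookup k (from r) ∸ lookup k′ (from r)) (shift-self t₁ (κ σ) self) κ-end)
                  (ℕ.n∸n≡0 (lookup (κ σ) (from r)))

  dropZero-zeros : ∀ {τ} → All (λ t → factor t ≡ 0) τ → dropZero τ ≡ []
  dropZero-zeros zeros = filter-none (λ t → ¬? (factor t ℕ.≟ 0)) (All.map (λ eq ne → ne eq) zeros)

  count-rules : ∀ r τ → count r τ ≡ ∑ (λ s → δ s r) (rules τ)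
  count-rules r τ = cong sum (map-∘ τ)

  unique-count : ∀ {r : RuleId} {rs} → Unique rs → ∑ (λ s → δ s r) rs ≤ 1
  unique-count []                              = z≤n
  unique-count {r} {s ∷ rs} (s∉ ∷ uniq) with s Fin.≟ r
  ... | no  _    = unique-count uniq
  ... | yes refl = ℕ.≤-reflexive (cong suc (∑-zero (All.map (δ-≢ ∘ ≢-sym) s∉)))

  loopSchedule-count : ∀ {L} → IsLoop L → ∀ r σ τ → count r (loopSchedule L σ τ) ≤ 2
  loopSchedule-count {L} (_ , uniq) r σ τ =
    ℕ.≤-trans (∑-filter-≤ (λ t → ¬? (factor t ℕ.≟ 0)) _ (loopFactors L σ τ)) count-factors
    where
    uniqueL : Unique L
    uniqueL = AllPairs.map (λ ne eq → ne (cong from eq)) (AllPairs.map⁻ uniq)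

    count-factors : count r (loopFactors L σ τ) ≤ 2
    count-factors with span (_∈? rules τ) L | span-spec (_∈? rules τ) L
    ... | _ , [] | _ = begin
      count r (twoRounds L σ (run τ σ))                   ≡⟨ count-rules r (twoRounds L σ (run τ σ)) ⟩
      ∑ (λ s → δ s r) (rules (twoRounds L σ (run τ σ)))   ≡⟨ cong (∑ (λ s → δ s r)) (twoRounds-rules L σ (run τ σ)) ⟩
      ∑ (λ s → δ s r) (L ++ L)                            ≡⟨ ∑-++ _ L L ⟩
      ∑ (λ s → δ s r) L + ∑ (λ s → δ s r) L               ≤⟨ ℕ.+-mono-≤ (unique-count uniqueL) (unique-count uniqueL) ⟩
      2                                                   ∎
      where open ℕ.≤-Reasoning
    ... | before , s ∷ after | refl , _ = begin
      count r (totals τ (after ++ before))                ≡⟨ cong sum (map-∘ (after ++ before)) ⟨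
      ∑ (λ s → δ s r) (after ++ before)                   ≤⟨ unique-count (AllPairs.tail (Unique-resp-↭ (Perm.++-comm before (s ∷ after)) uniqueL)) ⟩
      1                                                   ≤⟨ s≤s z≤n ⟩
      2                                                   ∎
      where open ℕ.≤-Reasoning

  module _ (SA : StandingAssumptions) {L} (loop : IsLoop L) where
    open StandingAssumptions SA

    InLoop : Schedule → Set
    InLoop = All (λ t → ruleOf t ∈ L)

    -- Rules on cycles update no shared variable. So the factors on a loop may be changed freely as
    -- far as the guards are concerned.
    loop-gain : ∀ i {τ} → InLoop τ → wsum (gain i) τ ≡ 0
    loop-gain i = ∑-zero ∘ All.map (λ {t} t∈ → trans
      (cong (λ v → factor t * lookup v i) (cycle-no-update (loop-onCycle loop t∈)))
      (trans (cong (factor t *_) (Vec.lookup-replicate i 0)) (ℕ.*-zeroʳ (factor t))))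

    nonzero-rules : ∀ {rs} τ → (∀ {t} → t ∈ τ → factor t ≢ 0 → ruleOf t ∈ rs) → rules (dropZero τ) ⊆ rs
    nonzero-rules τ h r∈ with ∈-map⁻ ruleOf r∈
    ... | t , t∈ , refl with ∈-filter⁻ (λ t → ¬? (factor t ℕ.≟ 0)) {xs = τ} t∈
    ...   | t∈τ , ≢0 = h t∈τ ≢0

    -- `τ′` may list rules that never occur in `τ`; these have factor 0 and vanish in `dropZero`, so
    -- occurrence is asked only for nonzero factors.
    rep-loop′ : ∀ {c k} τ τ′ → InLoop τ → Feasible c k τ′ → shifts τ′ k ≡ shifts τ k →
      (∀ {t} → t ∈ τ′ → factor t ≢ 0 → ruleOf t ∈ rules τ) → Rep c k τ (dropZero τ′)
    rep-loop′ τ τ′ inside fea end h = rep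
      (feasible-dropZero τ′ fea)
      (trans (shifts-dropZero τ′ fea) end)
      (λ i → trans (loop-gain i inside′) (sym (loop-gain i inside)))
      ⊆rules
      where
      ⊆rules = nonzero-rules τ′ h
      inside′ : InLoop (dropZero τ′)
      inside′ = All.tabulate (λ t∈ → All.lookup (All.map⁺ inside) (⊆rules (∈-map⁺ ruleOf t∈)))

    rep-loop : ∀ {c} τ σ → c ≤ᵏ κ σ → Feasible c (κ σ) τ → InLoop τ → Rep c (κ σ) τ (loopSchedule L σ τ)
    rep-loop {c} τ σ c≤κ fea inside with loop-selfLoop loop
    ... | inj₁ (r , refl , self) = subst (Rep c (κ σ) τ)
      (sym (dropZero-zeros (trivialLoop-factors self σ τ selfs)))
      (rep tt (sym (shifts-self τ selfs)) (λ i → sym (loop-gain i inside)) (λ ()))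
      where selfs = All.map (λ { (here refl) → self }) inside
    ... | inj₂ nonself with span (_∈? rules τ) L | span-spec (_∈? rules τ) L
    ...   | before , [] | L≡ , before⊆ , _ = go L loop nonself inside refl
      where
      -- `twoRounds-correct` singles out the first rule, so the fixed loop `L` has to be split; it
      -- enters as a variable `L′` with an equation.
      go : ∀ L′ → IsLoop L′ → All (¬_ ∘ SelfLoop) L′ → All (λ t → ruleOf t ∈ L′) τ → L′ ≡ L →
        Rep c (κ σ) τ (dropZero (twoRounds L′ σ (run τ σ)))
      go []       ((L≢[] , _) , _)           _       _       _    = contradiction refl L≢[]
      go (r ∷ rs) ((_ , _ , w) , uniq) nonself inside refl
        with fea′ , end ← twoRounds-correct r rs τ σ w uniq nonself inside c≤κ fea =
        rep-loop′ τ (twoRounds (r ∷ rs) σ (run τ σ)) inside fea′ end λ t∈ _ → All.lookup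
          (All.map⁻ (subst (All (_∈ rules τ)) (sym (twoRounds-rules (r ∷ rs) σ (run τ σ))) (All.++⁺ all∈ all∈))) t∈
        where
        all∈ : All (_∈ rules τ) (r ∷ rs)
        all∈ = subst (All (_∈ rules τ)) (sym (trans L≡ (++-identityʳ before))) before⊆
    ...   | before , s ∷ after | refl , _ , s∉ =
      rep-loop′ τ (totals τ rs) inside (proj₁ correct) (proj₂ correct) occurs
      where
      s-absent : s ∉ rules τ
      s-absent = s∉ refl
      rs = after ++ before

      walk : ∃ λ ℓ → Walk ℓ (before ++ s ∷ after) ℓ
      walk = proj₂ (proj₁ loop)

      -- Cutting the absent rule `s` out of the loop leaves a simple walk from its target around to
      -- its source.
      simple : SimpleWalk (to s) rs (from s)
      simple with walk-++⁻ before (proj₂ walk)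
      ... | _ , w₁ , (eq , w₂) with Unique-resp-↭ (Perm.map⁺ from (Perm.++-comm before (s ∷ after))) (proj₂ loop)
      ...   | s∉ ∷ uniq = subst (Walk (to s) rs) (sym eq) (walk-++ after w₂ w₁) , uniq , λ s∈ → All.lookup s∉ s∈ refl

      inside′ : All (λ t → ruleOf t ∈ rs) τ
      inside′ = All.tabulate λ t∈ → case Perm.∈-resp-↭ (Perm.++-comm before (s ∷ after)) (All.lookup inside t∈) of λ
        { (here eq) → contradiction (subst (_∈ rules τ) eq (∈-map⁺ ruleOf t∈)) s-absent ; (there r∈) → r∈ }

      correct = simpleWalk-totals-correct rs τ simple inside′ c≤κ fea

      occurs : ∀ {t} → t ∈ totals τ rs → factor t ≢ 0 → ruleOf t ∈ rules τ
      occurs t∈ ≢0 with ∈-map⁻ (λ r → ⟨ r , totalFactor r τ ⟩) t∈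
      ... | r , _ , refl with r ∈? rules τ
      ...   | yes r∈ = r∈
      ...   | no  r∉ = contradiction (totalFactor-∉ r τ r∉) ≢0

    loopSchedule-nonself : ∀ {c} τ σ → c ≤ᵏ κ σ → Feasible c (κ σ) τ → InLoop τ →
      All (¬_ ∘ SelfLoop ∘ ruleOf) (loopSchedule L σ τ)
    loopSchedule-nonself {c} τ σ c≤κ fea inside with loop-selfLoop loop
    ... | inj₁ (r , refl , self) rewrite dropZero-zeros (trivialLoop-factors self σ τ
      (All.map (λ { (here refl) → self }) inside)) = []
    ... | inj₂ nonself = All.tabulate λ t∈ → All.lookup nonself
      (All.lookup (All.map⁺ inside) (Rep.rules-⊆ (rep-loop τ σ c≤κ fea inside) (∈-map⁺ ruleOf t∈)))

  -- Replacing the loops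

  walk-≺P⁺ : ∀ {r u ℓ} rs → Walk (to r) rs ℓ → u ∈ rs → r ≺P⁺ u
  walk-≺P⁺ (_ ∷ rs) (eq , w) (here refl) = TransClosure.[ sym eq ]
  walk-≺P⁺ (_ ∷ rs) (eq , w) (there u∈)  = sym eq ∷ walk-≺P⁺ rs w u∈

  loop-≺P⁺ : ∀ {L r u} → IsLoop L → r ∈ L → u ∈ L → r ≢ u → r ≺P⁺ u
  loop-≺P⁺ ((_ , _ , w) , _) r∈ u∈ r≢u with rotate w r∈
  ... | rs , (_ , w′) , L↭ with Perm.∈-resp-↭ L↭ u∈
  ...   | here u≡r = contradiction (sym u≡r) r≢u
  ...   | there u∈rs = walk-≺P⁺ rs w′ u∈rs

  loop-∼P : ∀ {L r u} → IsLoop L → r ∈ L → u ∈ L → r ∼P u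
  loop-∼P {r = r} {u} loop r∈ u∈ with r Fin.≟ u
  ... | yes eq = inj₂ eq
  ... | no  ne = inj₁ (loop-≺P⁺ loop r∈ u∈ ne , loop-≺P⁺ loop u∈ r∈ (≢-sym ne))

  all-rules : ∀ {P : RuleId → Set} {τ τ′} → rules τ′ ⊆ rules τ → All (P ∘ ruleOf) τ → All (P ∘ ruleOf) τ′
  all-rules τ′⊆τ ps = All.map⁻ (Subset.All-resp-⊇ τ′⊆τ (All.map⁺ ps))

  -- In each exchange one of the two transitions is a self-loop, which neither changes the counters
  -- nor has a counter condition in `Safe`.
  feasible-delay : ∀ {c k u τ₂} τ₁ → All (λ t → SelfLoop (ruleOf u) ⊎ SelfLoop (ruleOf t)) τ₁ →
    Feasible c k (u ∷ τ₁ ++ τ₂) → Feasible c k (τ₁ ++ u ∷ τ₂)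
  feasible-delay [] [] fea = fea
  feasible-delay {c} {k} {u} {τ₂} (t ∷ τ₁) (inj₁ self ∷ selfs) (_ , s , fea) =
    subst (λ k → Safe c k t) (shift-self u k self) s ,
    feasible-delay τ₁ selfs (idle self , subst (λ k → Feasible c k (τ₁ ++ τ₂))
      (trans (cong (shift t) (shift-self u k self)) (sym (shift-self u _ self))) fea)
  feasible-delay {c} {k} {u} {τ₂} (t ∷ τ₁) (inj₂ self ∷ selfs) (s , _ , fea) =
    idle self , subst (λ k → Feasible c k (τ₁ ++ u ∷ τ₂)) (sym (shift-self t k self))
      (feasible-delay τ₁ selfs (s , subst (λ k → Feasible c k (τ₁ ++ τ₂)) (shift-self t _ self) fea))

  module _ (SA : StandingAssumptions) (lin : LinearExtension) {L} (loop : IsLoop L) where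
    open StandingAssumptions SA
    open Order lin

    inL? = InLoop? L
    outL? = λ t → ¬? (InLoop? L t)

    -- For `u` before `t`: the pairs that collecting the transitions of `L` at the front will
    -- exchange.
    Gap : Transition → Transition → Set
    Gap u t = ruleOf u ∉ L → ruleOf t ∈ L → SelfLoop (ruleOf u) ⊎ SelfLoop (ruleOf t)

    feasible-partition : ∀ {c k} τ → AllPairs Gap τ → Feasible c k τ →
      Feasible c k (filter inL? τ ++ filter outL? τ)
    feasible-partition []      []          _         = tt
    feasible-partition (u ∷ τ) (gap ∷ gaps) (s , fea) with ruleOf u ∈? L
    ... | yes _  = s , feasible-partition τ gaps fea
    ... | no  u∉ = feasible-delay (filter inL? τ)
      (All.tabulate λ t∈ → case ∈-filter⁻ inL? {xs = τ} t∈ of λ (t∈τ , t∈L) → All.lookup gap t∈τ u∉ t∈L)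
      (s , feasible-partition τ gaps fea)

    rep-partition : ∀ {c k} τ → AllPairs Gap τ → Feasible c k τ → Rep c k τ (filter inL? τ ++ filter outL? τ)
    rep-partition τ gaps fea = rep-sums fea (feasible-partition τ gaps fea)
      (λ w → ∑-filter inL? (λ t → factor t * w (ruleOf t)) τ) λ r∈ → case ∈-map⁻ ruleOf r∈ of λ
        { (t , t∈ , refl) → ∈-map⁺ ruleOf (case ∈-++⁻ (filter inL? τ) t∈ of λ
          { (inj₁ t∈₁) → proj₁ (∈-filter⁻ inL? t∈₁) ; (inj₂ t∈₂) → proj₁ (∈-filter⁻ outL? {xs = τ} t∈₂) }) }

    -- A transition `u` between `t₀` and `t`, both of `L`, is confined to their class by sortedness.
    -- Being outside `L`, it is a self-loop, unless `L` itself is a self-loop and `t` is one.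
    sorted-gap : ∀ {t₀ τ} → ruleOf t₀ ∈ L → All (t₀ ≼_) τ → Sorted τ → AllPairs Gap τ
    sorted-gap {t₀} t₀∈ = allPairs-map (λ {u} {t} → gap {u} {t})
      where
      gap : ∀ {u t} → t₀ ≼ u → t₀ ≼ t → u ≼ t → Gap u t
      gap {u} {t} t₀≼u _ u≼t u∉ t∈ with loop-selfLoop loop
      ... | inj₁ (r , refl , self) = inj₂ (case t∈ of λ { (here eq) → subst SelfLoop (sym eq) self })
      ... | inj₂ nonself = inj₁ (class-of-loop simple-cycles loop nonself t₀∈
        (≼-antisym {t₀} {u} t₀≼u (≼-trans {u} {t} {t₀} u≼t (∼P⇒≼ {t} {t₀} (loop-∼P loop t∈ t₀∈)))) u∉)

    -- The last two fields serve the iteration over all loops: bounds obtained for other loops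
    -- persist, and self-loops deleted earlier do not come back.
    record LoopReplaced (c : Reserve) (σ : Config) (τ τ′ : Schedule) : Set where
      field
        represents : Rep c (κ σ) τ τ′
        sorted     : Sorted τ′
        count-∈    : ∀ {r} → r ∈ L → count r τ′ ≤ 2
        count-∉L   : ∀ {r} → r ∉ L → count r τ′ ≡ count r τ
        self-loops : ∀ {t} → t ∈ τ′ → SelfLoop (ruleOf t) → t ∈ τ × ruleOf t ∉ L

    replaceLoop-correct : ∀ {c} σ τ → c ≤ᵏ κ σ → Feasible c (κ σ) τ → Sorted τ →
      LoopReplaced c σ τ (replaceLoop σ L τ)
    replaceLoop-correct {c} σ τ c≤κ fea sorted with span outL? τ | span-spec outL? τ
    ... | before , rest | refl , before⊆ , head∈
      with fea₁ , fea₂ ← feasible-++⁻ before fea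
         | sorted₁ , sorted₂ , sorted₁₂ ← allPairs-++⁻ before sorted = record
      { represents = rep-++ˡ before fea₁ (rep-trans R₁ R₂)
      ; sorted     = AllPairs.++⁺ sorted₁ (AllPairs.++⁺ new-sorted (AllPairs.filter⁺ outL? sorted₂) new≼others)
          (All.map (λ {t} t≼ → all-rules (Rep.rules-⊆ (rep-trans R₁ R₂)) t≼) sorted₁₂)
      ; count-∈    = λ {r} r∈ → begin
          count r (before ++ new ++ others)                ≡⟨ count-split r ⟩
          count r before + (count r new + count r others)  ≡⟨ cong₂ (λ m n → m + (count r new + n)) (count-outside r∈ before⊆) (count-outside r∈ (All.all-filter outL? rest)) ⟩
          count r new + 0                                  ≡⟨ ℕ.+-identityʳ _ ⟩
          count r new                                      ≤⟨ loopSchedule-count loop r σ₁ _ ⟩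
          2                                                ∎
      ; count-∉L   = λ {r} r∉ → ≡.begin
          count r (before ++ new ++ others)                         ≡.≡⟨ count-split r ⟩
          count r before + (count r new + count r others)           ≡.≡⟨ cong (λ n → count r before + (n + count r others)) (count-inside r∉ new-inside) ⟩
          count r before + count r others                           ≡.≡⟨ cong (λ n → count r before + (n + count r others)) (count-inside r∉ inside) ⟨
          count r before + (count r ours + count r others)          ≡.≡⟨ cong (count r before +_) (∑-++ _ ours others) ⟨
          count r before + count r (ours ++ others)                 ≡.≡⟨ cong (count r before +_) (∑-filter inL? _ rest) ⟩
          count r before + count r rest                             ≡.≡⟨ ∑-++ _ before rest ⟨
          count r (before ++ rest)                                  ≡.∎
      ; self-loops = λ {t} t∈ self → case ∈-++⁻ before t∈ of λ
          { (inj₁ t∈before) → ∈-++⁺ˡ t∈before , All.lookup before⊆ t∈before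
          ; (inj₂ t∈rest) → case ∈-++⁻ new t∈rest of λ
            { (inj₁ t∈new) → contradiction self (All.lookup (loopSchedule-nonself SA loop ours σ₁ c≤κ₁ fea-ours inside) t∈new)
            ; (inj₂ t∈others) → case ∈-filter⁻ outL? {xs = rest} t∈others of λ
              (t∈rest , t∉) → ∈-++⁺ʳ before t∈rest , t∉ } }
      }
      where
      open ℕ.≤-Reasoning
      module ≡ = ≡-Reasoning
      σ₁ = run before σ
      ours = filter inL? rest
      others = filter outL? rest
      new = loopSchedule L σ₁ ours

      κσ₁ : κ σ₁ ≡ shifts before (κ σ)
      κσ₁ = κ-run before σ

      count-outside : ∀ {r τ} → r ∈ L → All (λ t → ruleOf t ∉ L) τ → count r τ ≡ 0
      count-outside r∈ = count-∉ ∘ All.map (λ { t∉ refl → t∉ r∈ })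

      count-inside : ∀ {r τ} → r ∉ L → InLoop SA loop τ → count r τ ≡ 0
      count-inside r∉ = count-∉ ∘ All.map (λ { t∈ refl → r∉ t∈ })

      count-split : ∀ r → count r (before ++ new ++ others) ≡ count r before + (count r new + count r others)
      count-split r = trans (∑-++ _ before (new ++ others)) (cong (count r before +_) (∑-++ _ new others))

      c≤κ₁ : c ≤ᵏ κ σ₁
      c≤κ₁ = subst (c ≤ᵏ_) (sym κσ₁) (shifts-≥ before fea₁ c≤κ)

      -- `span` stops at the first transition of the loop, up to a double negation. It anchors the
      -- comparison of classes: by sortedness nothing after it belongs to an earlier class.
      head≼ : rest ≡ [] ⊎ ∃ λ t₀ → ruleOf t₀ ∈ L × All (t₀ ≼_) rest
      head≼ = go rest head∈ sorted₂
        where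
        go : ∀ rest → (∀ {t τ} → rest ≡ t ∷ τ → ¬ ruleOf t ∉ L) → Sorted rest →
          rest ≡ [] ⊎ ∃ λ t₀ → ruleOf t₀ ∈ L × All (t₀ ≼_) rest
        go []      _     _               = inj₁ refl
        go (t ∷ τ) head∈ (t≼ ∷ _) = inj₂ (t , decidable-stable (ruleOf t ∈? L) (head∈ refl) , ≼-refl {t} ∷ t≼)

      gaps : AllPairs Gap rest
      gaps with head≼
      ... | inj₁ eq              = subst (AllPairs Gap) (sym eq) []
      ... | inj₂ (t₀ , t₀∈ , t≼) = sorted-gap {t₀} t₀∈ t≼ sorted₂

      R₁ : Rep c (shifts before (κ σ)) rest (ours ++ others)
      R₁ = rep-partition rest gaps fea₂

      fea-both : Feasible c (κ σ₁) ours × Feasible c (shifts ours (κ σ₁)) others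
      fea-both = feasible-++⁻ ours (subst (λ k → Feasible c k (ours ++ others)) (sym κσ₁) (Rep.feasible R₁))
      fea-ours = proj₁ fea-both

      inside : InLoop SA loop ours
      inside = All.all-filter inL? rest

      R : Rep c (κ σ₁) ours new
      R = rep-loop SA loop ours σ₁ c≤κ₁ fea-ours inside

      R₂ : Rep c (shifts before (κ σ)) (ours ++ others) (new ++ others)
      R₂ = subst (λ k → Rep c k (ours ++ others) (new ++ others)) κσ₁ (rep-++ʳ others R (proj₂ fea-both))

      new-inside : InLoop SA loop new
      new-inside = all-rules {P = _∈ L} {ours} {new} (Rep.rules-⊆ R) inside

      new-sorted : Sorted new
      new-sorted = allPairs-all (λ {t} {u} t∈ u∈ → ∼P⇒≼ {t} {u} (loop-∼P loop t∈ u∈)) new-inside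

      new≼others : All (λ t → All (t ≼_) others) new
      new≼others with head≼
      ... | inj₁ eq = All.universal (λ t → subst (λ τ → All (t ≼_) (filter outL? τ)) (sym eq) []) new
      ... | inj₂ (t₀ , t₀∈ , t₀≼) = All.map (λ {t} t∈ → All.filter⁺ outL? (All.map
        (λ {u} → ≼-trans {t} {t₀} {u} (∼P⇒≼ {t} {t₀} (loop-∼P loop t∈ t₀∈))) t₀≼)) new-inside

  -- Simple representatives

  module _ (SA : StandingAssumptions) (lin : LinearExtension) (enum : LoopEnumeration) where
    open LoopEnumeration enum
    open Order lin

    record LoopsReplaced (c : Reserve) (σ : Config) (loops : List (List RuleId)) (τ τ′ : Schedule) : Set where
      field
        represents : Rep c (κ σ) τ τ′
        sorted     : Sorted τ′
        count-∈    : ∀ {r} → r ∈ concat loops → count r τ′ ≤ 2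
        count-∉L   : ∀ {r} → r ∉ concat loops → count r τ′ ≡ count r τ
        self-loops : ∀ {t} → t ∈ τ′ → SelfLoop (ruleOf t) → ruleOf t ∉ concat loops

    replaceLoops-correct : ∀ {c τ} σ loops → All IsLoop loops → c ≤ᵏ κ σ → Feasible c (κ σ) τ → Sorted τ →
      LoopsReplaced c σ loops τ (foldr (replaceLoop σ) τ loops)
    replaceLoops-correct σ [] [] c≤κ fea sorted = record
      { represents = rep-refl fea
      ; sorted     = sorted
      ; count-∈    = λ ()
      ; count-∉L   = λ _ → refl
      ; self-loops = λ _ _ ()
      }
    replaceLoops-correct {c} {τ} σ (L ∷ loops) (loop ∷ isLoops) c≤κ fea sorted = record
      { represents = rep-trans IH.represents Step.represents
      ; sorted     = Step.sorted
      ; count-∈    = λ {r} r∈ → case r ∈? L of λ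
          { (yes r∈L) → Step.count-∈ r∈L
          ; (no r∉L)  → case ∈-++⁻ L r∈ of λ
            { (inj₁ r∈L)     → contradiction r∈L r∉L
            ; (inj₂ r∈loops) → ℕ.≤-trans (ℕ.≤-reflexive (Step.count-∉L r∉L)) (IH.count-∈ r∈loops) } }
      ; count-∉L   = λ r∉ → trans (Step.count-∉L (r∉ ∘ ∈-++⁺ˡ)) (IH.count-∉L (r∉ ∘ ∈-++⁺ʳ L))
      ; self-loops = λ t∈ self r∈ → case Step.self-loops t∈ self of λ (t∈′ , r∉L) → case ∈-++⁻ L r∈ of λ
          { (inj₁ r∈L) → r∉L r∈L ; (inj₂ r∈loops) → IH.self-loops t∈′ self r∈loops }
      }
      where
      module IH = LoopsReplaced (replaceLoops-correct σ loops isLoops c≤κ fea sorted)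
      module Step = LoopReplaced (replaceLoop-correct SA lin loop σ (foldr (replaceLoop σ) τ loops) c≤κ
        (Rep.feasible IH.represents) IH.sorted)

    record SrepCorrect (c : Reserve) (σ : Config) (τ : Schedule) : Set where
      field
        represents : Rep c (κ σ) τ (srep lin enum σ τ)
        no-selfs   : All (¬_ ∘ SelfLoop ∘ ruleOf) (srep lin enum σ τ)
        short      : length (srep lin enum σ τ) ≤ 2 * nR

    length-counts : ∀ τ → length τ ≡ ∑ (λ r → count r τ) (allFin nR)
    length-counts []      = sym (∑-zero (All.universal (λ _ → refl) (allFin nR)))
    length-counts (t ∷ τ) = begin
      suc (length τ)                                                 ≡⟨ cong₂ _+_ (sym (∑-δ (AllPairs.tabulate⁺ id) (∈-allFin (ruleOf t)))) (length-counts τ) ⟩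
      ∑ (δ (ruleOf t)) (allFin nR) + ∑ (λ r → count r τ) (allFin nR) ≡⟨ ∑-+ (δ (ruleOf t)) (λ r → count r τ) (allFin nR) ⟨
      ∑ (λ r → count r (t ∷ τ)) (allFin nR)                          ∎
      where open ≡-Reasoning

    -- A self-loop is a cycle, so the enumeration lists it and it gets deleted. Rules on cycles
    -- occur at most twice by the replacement of their loop, all others at most once by merging.
    srep-correct : ∀ {c} σ τ → c ≤ᵏ κ σ → Feasible c (κ σ) τ → SrepCorrect c σ τ
    srep-correct {c} σ τ c≤κ fea = record
      { represents = rep-trans R Loops.represents
      ; no-selfs   = All.tabulate λ t∈ self → Loops.self-loops t∈ self (complete (self-onCycle self))
      ; short      = begin
          length τ′                             ≡⟨ length-counts τ′ ⟩
          ∑ (λ r → count r τ′) (allFin nR)      ≤⟨ ∑-mono {k = λ _ → 2 * 1} (All.universal count-≤ (allFin nR)) ⟩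
          ∑ (λ _ → 2 * 1) (allFin nR)           ≡⟨ ∑-* 2 (λ _ → 1) (allFin nR) ⟩
          2 * ∑ (λ _ → 1) (allFin nR)           ≡⟨ cong (2 *_) (trans {j = length (allFin nR)} (∑-one (allFin nR)) (length-tabulate {n = nR} id)) ⟩
          2 * nR                                ∎
      }
      where
      open ℕ.≤-Reasoning
      τ₁ = Swapping.swapAll lin τ
      τ′ = srep lin enum σ τ

      R₁ : Rep c (κ σ) τ τ₁
      R₁ = rep-swaps (Swapping.swapAll-reached lin τ) fea

      R : Rep c (κ σ) τ (merge τ₁)
      R = rep-trans R₁ (rep-merge τ₁ (Rep.feasible R₁))

      module Loops = LoopsReplaced (replaceLoops-correct σ loops sound c≤κ (Rep.feasible R)
        (merge-sorted (swapAll-sorted τ)))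

      ∑-one : ∀ {A : Set} (xs : List A) → ∑ (λ _ → 1) xs ≡ length xs
      ∑-one []       = refl
      ∑-one (x ∷ xs) = cong suc (∑-one xs)

      count-≤ : ∀ r → count r τ′ ≤ 2
      count-≤ r with r ∈? concat loops
      ... | yes r∈ = Loops.count-∈ r∈
      ... | no  r∉ = begin
        count r τ′         ≡⟨ Loops.count-∉L r∉ ⟩
        count r (merge τ₁) ≤⟨ merge-count (r∉ ∘ complete) (swapAll-sorted τ) ⟩
        1                  ≤⟨ s≤s z≤n ⟩
        2                  ∎

  -- Shared variables and guards

  infix 4 _≤ᵍ_
  _≤ᵍ_ : Vec ℕ nΓ → Vec ℕ nΓ → Set
  u ≤ᵍ v = ∀ i → lookup u i ≤ lookup v i

  config-≡ : ∀ {σ σ′} → κ σ ≡ κ σ′ → g σ ≡ g σ′ → p σ ≡ p σ′ → σ ≡ σ′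
  config-≡ refl refl refl = refl

  g-fire : ∀ t σ i → lookup (g (fire t σ)) i ≡ lookup (g σ) i + factor t * gain i (ruleOf t)
  g-fire t σ i = trans (Vec.lookup-zipWith _+_ i (g σ) _)
    (cong (lookup (g σ) i +_) (Vec.lookup-map i (factor t *_) (update (ruleOf t))))

  g-run : ∀ τ σ i → lookup (g (run τ σ)) i ≡ lookup (g σ) i + wsum (gain i) τ
  g-run []      σ i = sym (ℕ.+-identityʳ _)
  g-run (t ∷ τ) σ i = trans (g-run τ (fire t σ) i)
    (trans (cong (_+ wsum (gain i) τ) (g-fire t σ i)) (ℕ.+-assoc (lookup (g σ) i) _ _))

  p-run : ∀ τ σ → p (run τ σ) ≡ p σ
  p-run []      σ = refl
  p-run (t ∷ τ) σ = p-run τ (fire t σ)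

  g-grows : ∀ τ σ → g σ ≤ᵍ g (run τ σ)
  g-grows τ σ i = ℕ.≤-trans (ℕ.m≤m+n _ _) (ℕ.≤-reflexive (sym (g-run τ σ i)))

  run-++ : ∀ τ τ′ σ → run (τ ++ τ′) σ ≡ run τ′ (run τ σ)
  run-++ []      τ′ σ = refl
  run-++ (t ∷ τ) τ′ σ = run-++ τ τ′ (fire t σ)

  rep-run : ∀ {c τ τ′} σ → Rep c (κ σ) τ τ′ → run τ′ σ ≡ run τ σ
  rep-run {τ = τ} {τ′} σ R = config-≡
    (trans (κ-run τ′ σ) (trans (Rep.same-end R) (sym (κ-run τ σ))))
    (vec-ext λ i → trans (g-run τ′ σ i) (trans (cong (lookup (g σ) i +_) (Rep.same-gain R i)) (sym (g-run τ σ i))))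
    (trans (p-run τ′ σ) (sym (p-run τ σ)))

  all-Cfgs-++ : ∀ {P : Config → Set} {σ} τ {τ′} → All P (Cfgs σ τ) → All P (Cfgs (run τ σ) τ′) →
    All P (Cfgs σ (τ ++ τ′))
  all-Cfgs-++ []      _        ps′ = ps′
  all-Cfgs-++ (t ∷ τ) (p ∷ ps) ps′ = p ∷ all-Cfgs-++ τ ps ps′

  start∈Cfgs : ∀ τ σ → σ ∈ Cfgs σ τ
  start∈Cfgs []      σ = here refl
  start∈Cfgs (t ∷ τ) σ = here refl

  end∈Cfgs : ∀ τ σ → run τ σ ∈ Cfgs σ τ
  end∈Cfgs []      σ = here refl
  end∈Cfgs (t ∷ τ) σ = there (end∈Cfgs τ (fire t σ))

  Cfgs-reserve : ∀ {c} τ σ → Feasible c (κ σ) τ → c ≤ᵏ κ σ → All (λ σ′ → c ≤ᵏ κ σ′) (Cfgs σ τ)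
  Cfgs-reserve []      σ _         c≤κ = c≤κ ∷ []
  Cfgs-reserve (t ∷ τ) σ (s , fea) c≤κ = c≤κ ∷ Cfgs-reserve τ (fire t σ) fea (shift-≥ t s c≤κ)

  Cfgs-between : ∀ τ σ → All (λ σ′ → g σ ≤ᵍ g σ′ × g σ′ ≤ᵍ g (run τ σ) × p σ′ ≡ p σ) (Cfgs σ τ)
  Cfgs-between []      σ = ((λ _ → ℕ.≤-refl) , (λ _ → ℕ.≤-refl) , refl) ∷ []
  Cfgs-between (t ∷ τ) σ = ((λ _ → ℕ.≤-refl) , g-grows (t ∷ τ) σ , refl) ∷
    All.map (λ (lo , hi , eq) → (λ i → ℕ.≤-trans (g-grows [ t ] σ i) (lo i)) , hi , eq)
            (Cfgs-between τ (fire t σ))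

  sat-rise : ∀ u v {q} (φ : Guard nΓ nΠ rise) → u ≤ᵍ v → Sat u q φ → Sat v q φ
  sat-rise u v φ u≤v sat = ℤ.≤-trans sat (ℤ.+≤+ (u≤v (Guard.var φ)))

  sat-fall : ∀ u v {q} (φ : Guard nΓ nΠ fall) → u ≤ᵍ v → Sat v q φ → Sat u q φ
  sat-fall u v φ u≤v sat = ℤ.≤-<-trans (ℤ.+≤+ (u≤v (Guard.var φ))) sat

  -- As shared variables grow, lower guards become true and upper guards false, and the context
  -- collects precisely these.
  context-mono : ∀ {σ σ′} → g σ ≤ᵍ g σ′ → p σ ≡ p σ′ → ∀ {x} → Context σ x → Context σ′ x
  context-mono {σ} {σ′} g≤ p≡ {rise , φ} (φ∈ , sat) = φ∈ , subst (λ q → Sat (g σ′) q φ) p≡ (sat-rise (g σ) (g σ′) φ g≤ sat)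
  context-mono {σ} {σ′} g≤ p≡ {fall , φ} (φ∈ , ¬sat) =
    φ∈ , λ sat → ¬sat (sat-fall (g σ) (g σ′) φ g≤ (subst (λ q → Sat (g σ′) q φ) (sym p≡) sat))

  -- Asking for the guards on a whole interval makes the condition independent of the position in
  -- the schedule, so it survives reordering and acceleration.
  Guarded : (lo hi : Vec ℕ nΓ) (q : Vec ℕ nΠ) → RuleId → Set
  Guarded lo hi q r = ∀ v → lo ≤ᵍ v → v ≤ᵍ hi → ∀ kind → All (Sat v q) (guards r kind)

  feasible⇒applicable : ∀ {c} lo hi τ σ → Feasible c (κ σ) τ → All (¬_ ∘ SelfLoop ∘ ruleOf) τ →
    lo ≤ᵍ g σ → g (run τ σ) ≤ᵍ hi → All (Guarded lo hi (p σ) ∘ ruleOf) τ → Applicable σ τ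
  feasible⇒applicable lo hi []      σ _ _ _ _ _ = tt
  feasible⇒applicable {c} lo hi (t ∷ τ) σ (s , fea) (nonself ∷ nonselfs) lo≤ ≤hi (guarded ∷ guardeds) =
    inj₁ (unlocked , enough s) , feasible⇒applicable lo hi τ (fire t σ) fea nonselfs
      (λ i → ℕ.≤-trans (lo≤ i) (g-grows [ t ] σ i)) ≤hi guardeds
    where
    enough : Safe c (κ σ) t → factor t ≤ lookup (κ σ) (from (ruleOf t))
    enough (idle self) = contradiction self nonself
    enough (able le)   = ℕ.≤-trans (ℕ.m≤m+n _ _) le

    -- The values tested are those reached by firing the same rule with factor `k`, so monotonicity
    -- places them between `lo` and `hi`.
    unlocked : Unlocked σ t
    unlocked k k<f = guarded _
      (λ i → ℕ.≤-trans (lo≤ i) (ℕ.≤-trans (ℕ.m≤m+n _ _) (ℕ.≤-reflexive (sym (g-fire ⟨ ruleOf t , k ⟩ σ i)))))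
      (λ i → begin
        lookup (g (fire ⟨ ruleOf t , k ⟩ σ)) i           ≡⟨ g-fire ⟨ ruleOf t , k ⟩ σ i ⟩
        lookup (g σ) i + k * gain i (ruleOf t)           ≤⟨ ℕ.+-monoʳ-≤ (lookup (g σ) i) (ℕ.*-monoˡ-≤ (gain i (ruleOf t)) (ℕ.<⇒≤ k<f)) ⟩
        lookup (g σ) i + factor t * gain i (ruleOf t)    ≡⟨ g-fire t σ i ⟨
        lookup (g (fire t σ)) i                          ≤⟨ g-grows τ (fire t σ) i ⟩
        lookup (g (run τ (fire t σ))) i                  ≤⟨ ≤hi i ⟩
        _                                                ∎)
      where open ℕ.≤-Reasoning

  applicable⇒feasible : ∀ τ σ → Applicable σ τ → Feasible (λ _ → 0) (κ σ) τ
  applicable⇒feasible []      σ _         = tt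
  applicable⇒feasible (t ∷ τ) σ (en , app) = able (enough en) , applicable⇒feasible τ (fire t σ) app
    where
    enough : Enabled σ t → factor t + 0 ≤ lookup (κ σ) (from (ruleOf t))
    enough (inj₁ (_ , le)) = ℕ.≤-trans (ℕ.≤-reflexive (ℕ.+-identityʳ _)) le
    enough (inj₂ eq)       = subst (λ f → f + 0 ≤ _) (sym eq) z≤n

  -- With factor 1 a transition is tested for `k = 0` only, that is, at a visited configuration;
  -- factor 0, which would be enabled without any guard, is excluded.
  guards-satisfied : ∀ τ σ → Conventional τ → Applicable σ τ → ∀ {t} → t ∈ τ →
    ∃ λ σ′ → σ′ ∈ Cfgs σ τ × ∀ kind → All (Sat (g σ′) (p σ′)) (guards (ruleOf t) kind)
  guards-satisfied (⟨ r , .1 ⟩ ∷ τ) σ (refl ∷ _) (inj₁ (unlocked , _) , _) (here refl) =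
    σ , here refl , λ kind → subst (λ v → All (Sat v (p σ)) (guards r kind)) zero-steps (unlocked 0 (s≤s z≤n) kind)
    where
    zero-steps : g (fire ⟨ r , 0 ⟩ σ) ≡ g σ
    zero-steps = vec-ext λ i → trans (g-fire ⟨ r , 0 ⟩ σ i) (ℕ.+-identityʳ _)
  guards-satisfied (t ∷ τ) σ (_ ∷ conv) (_ , app) (there t∈) with guards-satisfied τ (fire t σ) conv app t∈
  ... | σ′ , σ′∈ , sat = σ′ , there σ′∈ , sat

  steady⇒guarded : ∀ {μ} → IsMultiplier μ → ∀ τ σ → Conventional τ → Applicable σ τ → Steady σ τ →
    ∀ {r} → r ∈ rules τ → Guarded (μ *ᵛ g σ) (μ *ᵛ g (run τ σ)) (μ *ᵛ p σ) r
  steady⇒guarded {μ} mult τ σ conv app steady r∈ v lo≤v v≤hi kind with ∈-map⁻ ruleOf r∈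
  ... | t , t∈ , refl with guards-satisfied τ σ conv app t∈
  ...   | σ′ , σ′∈ , sats = All.tabulate (holds kind)
    where
    open IsMultiplier mult
    holds : ∀ kind {φ} → φ ∈ guards (ruleOf t) kind → Sat v (μ *ᵛ p σ) φ
    holds rise {φ} φ∈ = sat-rise (μ *ᵛ g σ) v φ lo≤v (preserves-guards σ rise φ (_ , φ∈)
      (proj₂ (proj₁ (steady σ′∈ (start∈Cfgs τ σ)) {rise , φ} ((_ , φ∈) , All.lookup (sats rise) φ∈))))
    -- A context records an upper guard only when it fails. Steadiness thus refutes its failure at
    -- the end, and decidability yields that it holds.
    holds fall {φ} φ∈ = sat-fall v (μ *ᵛ g (run τ σ)) φ v≤hi (subst (λ q → Sat (μ *ᵛ g (run τ σ)) (μ *ᵛ q) φ) (p-run τ σ)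
      (preserves-guards (run τ σ) fall φ (_ , φ∈) (decidable-stable (_ ℤ.<? _) λ ¬sat →
        proj₂ (proj₂ (steady σ′∈ (end∈Cfgs τ σ)) {fall , φ} ((_ , φ∈) , ¬sat)) (All.lookup (sats fall) φ∈))))

  -- Repeating a schedule

  lookup-*ᵛ : ∀ {m} n (v : Vec ℕ m) i → lookup (n *ᵛ v) i ≡ n * lookup v i
  lookup-*ᵛ n v i = Vec.lookup-map i (n *_) v

  suc-*ᵛ-+ᵛ : ∀ n (k d : Counters) → suc n *ᵛ k +ᵛ d ≡ k +ᵛ (n *ᵛ k +ᵛ d)
  suc-*ᵛ-+ᵛ n k d = vec-ext λ i → begin
    lookup (suc n *ᵛ k +ᵛ d) i             ≡⟨ lookup-+ᵛ (suc n *ᵛ k) d i ⟩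
    lookup (suc n *ᵛ k) i + lookup d i     ≡⟨ cong (_+ lookup d i) (lookup-*ᵛ (suc n) k i) ⟩
    suc n * lookup k i + lookup d i        ≡⟨ ℕ.+-assoc (lookup k i) _ _ ⟩
    lookup k i + (n * lookup k i + lookup d i)     ≡⟨ cong (λ m → lookup k i + (m + lookup d i)) (lookup-*ᵛ n k i) ⟨
    lookup k i + (lookup (n *ᵛ k) i + lookup d i)  ≡⟨ cong (lookup k i +_) (lookup-+ᵛ (n *ᵛ k) d i) ⟨
    lookup k i + lookup (n *ᵛ k +ᵛ d) i            ≡⟨ lookup-+ᵛ k _ i ⟨
    lookup (k +ᵛ (n *ᵛ k +ᵛ d)) i                  ∎
    where open ≡-Reasoning

  +ᵛ-swap : ∀ (a b d : Counters) → a +ᵛ (b +ᵛ d) ≡ b +ᵛ (a +ᵛ d)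
  +ᵛ-swap a b d = trans (sym (Vec.zipWith-assoc ℕ.+-assoc a b d))
    (trans (cong (_+ᵛ d) (Vec.zipWith-comm ℕ.+-comm a b)) (Vec.zipWith-assoc ℕ.+-assoc b a d))

  -- Each round consumes one copy of `k`, using neither the remaining copies nor `d`, and its result
  -- joins the reserve of the later rounds. The induction therefore needs an arbitrary `d`.
  repeat-feasible : ∀ {k} τ → Feasible (λ _ → 0) k τ → ∀ n d →
    Feasible (lookup d) (n *ᵛ k +ᵛ d) (n ·ˢ τ) × shifts (n ·ˢ τ) (n *ᵛ k +ᵛ d) ≡ n *ᵛ shifts τ k +ᵛ d
  repeat-feasible {k} τ fea zero d = tt , vec-ext λ i → begin
    lookup (0 *ᵛ k +ᵛ d) i                  ≡⟨ lookup-+ᵛ (0 *ᵛ k) d i ⟩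
    lookup (0 *ᵛ k) i + lookup d i          ≡⟨ cong (_+ lookup d i) (trans (lookup-*ᵛ 0 k i) (sym (lookup-*ᵛ 0 (shifts τ k) i))) ⟩
    lookup (0 *ᵛ shifts τ k) i + lookup d i ≡⟨ lookup-+ᵛ (0 *ᵛ shifts τ k) d i ⟨
    lookup (0 *ᵛ shifts τ k +ᵛ d) i         ∎
    where open ≡-Reasoning
  repeat-feasible {k} τ fea (suc n) d rewrite suc-*ᵛ-+ᵛ n k d | suc-*ᵛ-+ᵛ n (shifts τ k) d =
    feasible-++⁺ τ
      (feasible-weaken τ (λ i → below (n *ᵛ k) i) (feasible-offset τ e fea))
      (subst (λ k → Feasible (lookup d) k (n ·ˢ τ)) (sym after)
        (feasible-weaken (n ·ˢ τ) (below (shifts τ k)) (proj₁ rest))) ,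
    trans (shifts-++ τ (n ·ˢ τ) (k +ᵛ e)) (trans (cong (shifts (n ·ˢ τ)) after)
      (trans (proj₂ rest) (+ᵛ-swap (n *ᵛ shifts τ k) (shifts τ k) d)))
    where
    e = n *ᵛ k +ᵛ d

    below : ∀ u i → lookup d i ≤ lookup (u +ᵛ d) i
    below u i = ℕ.≤-trans (ℕ.m≤n+m _ _) (ℕ.≤-reflexive (sym (lookup-+ᵛ u d i)))

    after : shifts τ (k +ᵛ e) ≡ n *ᵛ k +ᵛ (shifts τ k +ᵛ d)
    after = trans (shifts-offset τ e fea) (+ᵛ-swap (shifts τ k) (n *ᵛ k) d)

    rest = repeat-feasible τ fea n (shifts τ k +ᵛ d)

  wsum-repeat : ∀ w n τ → wsum w (n ·ˢ τ) ≡ n * wsum w τ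
  wsum-repeat w zero    τ = refl
  wsum-repeat w (suc n) τ = trans (∑-++ _ τ (n ·ˢ τ)) (cong (wsum w τ +_) (wsum-repeat w n τ))

  g-repeat : ∀ {μ} (mult : IsMultiplier μ) τ σ →
    g (run (μ ·ˢ τ) (scale mult σ)) ≡ μ *ᵛ g (run τ σ)
  g-repeat {μ} mult τ σ = vec-ext λ i → begin
    lookup (g (run (μ ·ˢ τ) (scale mult σ))) i         ≡⟨ g-run (μ ·ˢ τ) (scale mult σ) i ⟩
    lookup (μ *ᵛ g σ) i + wsum (gain i) (μ ·ˢ τ)       ≡⟨ cong₂ _+_ (lookup-*ᵛ μ (g σ) i) (wsum-repeat (gain i) μ τ) ⟩
    μ * lookup (g σ) i + μ * wsum (gain i) τ           ≡⟨ ℕ.*-distribˡ-+ μ _ _ ⟨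
    μ * (lookup (g σ) i + wsum (gain i) τ)             ≡⟨ cong (μ *_) (g-run τ σ i) ⟨
    μ * lookup (g (run τ σ)) i                         ≡⟨ lookup-*ᵛ μ (g (run τ σ)) i ⟨
    lookup (μ *ᵛ g (run τ σ)) i                        ∎
    where open ≡-Reasoning

  -- Assembling the two halves of the representative

  ψ-reserve : ∀ {n} (Locs : Fin n → Subset nL) {c} σ σ′ → ψ Locs σ → (∀ ℓ → lookup (κ σ) ℓ ≤ c ℓ) →
    c ≤ᵏ κ σ′ → ψ Locs σ′
  ψ-reserve Locs σ σ′ ψσ κ≤c c≤κ m with ψσ m
  ... | ℓ , ℓ∈ , ≢0 = ℓ , ℓ∈ , λ ≡0 → ≢0 (ℕ.n≤0⇒n≡0 (ℕ.≤-trans (κ≤c ℓ) (ℕ.≤-trans (c≤κ ℓ) (ℕ.≤-reflexive ≡0))))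

  -- μ = n + 1, and d = (μ − 1)σ and e = τ(σ) are the processes to spare in the two parts.
  module Representative (SA : StandingAssumptions) (lin : LinearExtension) (enum : LoopEnumeration)
    {n} (mult : IsMultiplier (suc n)) (σ : Config) (τ : Schedule)
    (conv : Conventional τ) (app : Applicable σ τ) (steady : Steady σ τ) where

    k d e : Counters
    k = κ σ
    d = n *ᵛ k
    e = shifts τ k

    μσ σ₁ : Config
    μσ = scale mult σ
    σ₁ = run τ μσ

    A B ρ : Schedule
    A = srep lin enum μσ τ
    B = srep lin enum σ₁ (n ·ˢ τ)
    ρ = A ++ B

    fea : Feasible (λ _ → 0) k τ
    fea = applicable⇒feasible τ σ app

    κ-μσ : k +ᵛ d ≡ κ μσ
    κ-μσ = vec-ext λ i → trans (lookup-+ᵛ k d i)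
      (trans (cong (lookup k i +_) (lookup-*ᵛ n k i)) (sym (lookup-*ᵛ (suc n) k i)))

    κ-σ₁ : d +ᵛ e ≡ κ σ₁
    κ-σ₁ = begin
      d +ᵛ e            ≡⟨ Vec.zipWith-comm ℕ.+-comm d e ⟩
      e +ᵛ d            ≡⟨ shifts-offset τ d fea ⟨
      shifts τ (k +ᵛ d) ≡⟨ cong (shifts τ) κ-μσ ⟩
      shifts τ (κ μσ)   ≡⟨ κ-run τ μσ ⟨
      κ σ₁              ∎
      where open ≡-Reasoning

    d≤ : lookup d ≤ᵏ κ μσ
    d≤ i = subst (λ v → lookup d i ≤ lookup v i) κ-μσ
      (ℕ.≤-trans (ℕ.m≤n+m _ _) (ℕ.≤-reflexive (sym (lookup-+ᵛ k d i))))

    e≤ : lookup e ≤ᵏ κ σ₁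
    e≤ i = subst (λ v → lookup e i ≤ lookup v i) κ-σ₁
      (ℕ.≤-trans (ℕ.m≤n+m _ _) (ℕ.≤-reflexive (sym (lookup-+ᵛ d e i))))

    module First = SrepCorrect (srep-correct SA lin enum μσ τ d≤
      (subst (λ v → Feasible (lookup d) v τ) κ-μσ (feasible-offset τ d fea)))

    module Second = SrepCorrect (srep-correct SA lin enum σ₁ (n ·ˢ τ) e≤
      (subst (λ v → Feasible (lookup e) v (n ·ˢ τ)) κ-σ₁ (proj₁ (repeat-feasible τ fea n e))))

    run-A : run A μσ ≡ σ₁
    run-A = rep-run μσ First.represents

    run-ρ : run ρ μσ ≡ run (suc n ·ˢ τ) μσ
    run-ρ = begin
      run ρ μσ             ≡⟨ run-++ A B μσ ⟩
      run B (run A μσ)     ≡⟨ cong (run B) run-A ⟩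
      run B σ₁             ≡⟨ rep-run σ₁ Second.represents ⟩
      run (n ·ˢ τ) σ₁      ≡⟨ run-++ τ (n ·ˢ τ) μσ ⟨
      run (suc n ·ˢ τ) μσ  ∎
      where open ≡-Reasoning

    g-end : g (run ρ μσ) ≡ g (scale mult (run τ σ))
    g-end = trans (cong g run-ρ) (g-repeat mult τ σ)

    feasible-ρ : Feasible (λ _ → 0) (κ μσ) ρ
    feasible-ρ = feasible-++⁺ A (feasible-weaken A (λ _ → z≤n) (Rep.feasible First.represents))
      (subst (λ v → Feasible (λ _ → 0) v B) (trans (sym (cong κ run-A)) (κ-run A μσ))
        (feasible-weaken B (λ _ → z≤n) (Rep.feasible Second.represents)))

    rules-repeat : ∀ m → rules (m ·ˢ τ) ⊆ rules τ
    rules-repeat (suc m) {r} r∈ with ∈-++⁻ (rules τ) (subst (r ∈_) (map-++ ruleOf τ (m ·ˢ τ)) r∈)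
    ... | inj₁ r∈τ  = r∈τ
    ... | inj₂ r∈mτ = rules-repeat m r∈mτ

    guarded : ∀ {τ′} → rules τ′ ⊆ rules τ →
      All (Guarded (g μσ) (g (scale mult (run τ σ))) (p μσ) ∘ ruleOf) τ′
    guarded ⊆ = All.tabulate λ t∈ → steady⇒guarded mult τ σ conv app steady (⊆ (∈-map⁺ ruleOf t∈))

    applicable : Applicable μσ ρ
    applicable = feasible⇒applicable (g μσ) (g (scale mult (run τ σ))) ρ μσ feasible-ρ
      (All.++⁺ First.no-selfs Second.no-selfs) (λ _ → ℕ.≤-refl) (λ i → ℕ.≤-reflexive (cong (λ v → lookup v i) g-end))
      (All.++⁺ (guarded (Rep.rules-⊆ First.represents)) (guarded (rules-repeat n ∘ Rep.rules-⊆ Second.represents)))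

    -- Contexts only grow along ρ, from that of μσ to that of μτ(σ). Once the last is included in
    -- the first, all contexts in between coincide.
    steady-ρ : SameContext μσ (scale mult (run τ σ)) → Steady μσ ρ
    steady-ρ (_ , end⊆start) σ∈ σ′∈ = included σ∈ σ′∈ , included σ′∈ σ∈
      where
      included : ∀ {σ₂ σ₃} → σ₂ ∈ Cfgs μσ ρ → σ₃ ∈ Cfgs μσ ρ → ∀ {x} → Context σ₂ x → Context σ₃ x
      included {σ₂} {σ₃} σ₂∈ σ₃∈ with All.lookup (Cfgs-between ρ μσ) σ₂∈ | All.lookup (Cfgs-between ρ μσ) σ₃∈
      ... | _ , ≤end , p₂ | ≥start , _ , p₃ =
        context-mono {μσ} {σ₃} ≥start (sym p₃) ∘ end⊆start ∘ context-mono {σ₂} {scale mult (run τ σ)}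
          (λ i → ℕ.≤-trans (≤end i) (ℕ.≤-reflexive (cong (λ v → lookup v i) g-end)))
          (trans p₂ (cong (suc n *ᵛ_) (sym (p-run τ σ))))

    short : length ρ ≤ 4 * nR
    short = begin
      length ρ              ≡⟨ length-++ A ⟩
      length A + length B   ≤⟨ ℕ.+-mono-≤ First.short Second.short ⟩
      2 * nR + 2 * nR       ≡⟨ ℕ.*-distribʳ-+ nR 2 2 ⟨
      4 * nR                ∎
      where open ℕ.≤-Reasoning

    ψ-ρ : 0 < n → ∀ {m} (Locs : Fin m → Subset nL) → All (ψ Locs) (Cfgs σ τ) → All (ψ Locs) (Cfgs μσ ρ)
    ψ-ρ 0<n Locs ψs = all-Cfgs-++ A
      (All.map (λ {σ′} → ψ-reserve Locs σ σ′ (All.lookup ψs (start∈Cfgs τ σ)) k≤d)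
               (Cfgs-reserve A μσ (Rep.feasible First.represents) d≤))
      (subst (λ σ₁ → All (ψ Locs) (Cfgs σ₁ B)) (sym run-A)
        (All.map (λ {σ′} → ψ-reserve Locs (run τ σ) σ′ (All.lookup ψs (end∈Cfgs τ σ)) end≤e)
                 (Cfgs-reserve B σ₁ (Rep.feasible Second.represents) e≤)))
      where
      -- Here μ > 1 enters: the reserve (μ - 1)σ of the first half contains at least one full copy
      -- of σ.
      k≤d : ∀ ℓ → lookup k ℓ ≤ lookup d ℓ
      k≤d ℓ = begin
        lookup k ℓ      ≡⟨ ℕ.*-identityˡ _ ⟨
        1 * lookup k ℓ  ≤⟨ ℕ.*-monoˡ-≤ (lookup k ℓ) 0<n ⟩
        n * lookup k ℓ  ≡⟨ lookup-*ᵛ n k ℓ ⟨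
        lookup d ℓ      ∎
        where open ℕ.≤-Reasoning

      end≤e : ∀ ℓ → lookup (κ (run τ σ)) ℓ ≤ lookup e ℓ
      end≤e ℓ = ℕ.≤-reflexive (cong (λ v → lookup v ℓ) (κ-run τ σ))

theorem6p4 : (TA : ThresholdAutomaton) → let open CounterSystem TA in
    StandingAssumptions →
    (lin : LinearExtension) (enum : LoopEnumeration) →
    ∀ {μ} (mult : IsMultiplier μ) → 1 < μ →
    (σ : Config) (n : ℕ) (Locs : Fin n → Subset nL) (τ : Schedule) →
    Conventional τ → Applicable σ τ → Steady σ τ → All (ψ Locs) (Cfgs σ τ) →
    let μσ = scale mult σ in
    ∃ λ ρ →
    (Applicable μσ ρ
    × (SameContext μσ (scale mult (run τ σ)) → Steady μσ ρ)
    × run ρ μσ ≡ run (μ ·ˢ τ) μσ)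
    × length ρ ≤ 4 * nR
    × All (ψ Locs) (Cfgs μσ ρ)
    × ρ ≡ srep lin enum μσ τ ++ srep lin enum (run τ μσ) ((μ ∸ 1) ·ˢ τ)
theorem6p4 TA SA lin enum {suc _} mult (s≤s 0<n) σ _ Locs τ conv app steady ψs =
  ρ , (applicable , steady-ρ , run-ρ) , short , ψ-ρ 0<n Locs ψs , refl
  where
  open Representative TA SA lin enum mult σ τ conv app steady
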